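{- Let $G$ be a graph with $n\ge4$ vertices and $M=M[IAS(G)]$. Then the following are equivalent. \begin{enumerate} \item Some graph locally equivalent to $G$ has a vertex of degree $<\frac{n-1}{2}$. \item $M$ has a transverse circuit of size $<\frac{n+1}{2}$. \item There is a subset $X\subseteq V(G)$ such that $\tau_G(X)$ and $\tau_G(V(G)-X)$ both contain transverse circuits. \item $\kappa(M)<n$. \end{enumerate}
   Context: A graph is a finite looped simple graph; neighbors via non-loop edges, $N_G(v)=\{w\neq v\mid vw\in E(G)\}$, degree of $v$ is $|N_G(v)|$. $A(G)$ is the $GF(2)$ adjacency matrix (diagonal 1 iff looped). $M[IAS(G)]$ is the binary matroid represented by $(I\;A(G)\;A(G)+I)$, with elements $\phi_G(v),\chi_G(v),\psi_G(v)$ (the $v$ columns of $I,A(G),A(G)+I$); $\tau_G(v)=\{\phi_G(v),\chi_G(v),\psi_G(v)\}$, $\tau_G(X)=\bigcup_{x\in X}\tau_G(x)$. A transversal meets every vertex triple exactly once; a transverse circuit is a circuit of $M$ contained in some transversal. For a matroid on $W$ with rank $r$, $\lambda(S)=r(S)+r(W-S)-r(M)$; $S$ is a vertical $k$-separation if $\lambda(S)<k$ and $r(S),r(W-S)\ge k$; $\kappa(M)=\min(\{k\mid\text{vertical }k\text{ -separation exists}\}\cup\{r(M)\})$. Local equivalence: loop complement at $v$ reverses the loop status of $v$; simple local complement at $v$ reverses adjacencies between distinct neighbors of $v$; non-simple local complement additionally reverses loop status at all neighbors of $v$; locally equivalent graphs are related by a sequence of these operations. -}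

module Defs where

open import Data.Nat using (ℕ; zero; suc; _+_; _*_; _≤_; _<_)
open import Data.Bool using (Bool; true; false; not; _∧_; _xor_; if_then_else_)
open import Data.Fin using (Fin; _≟_)
open import Data.Product using (Σ; _×_; _,_)
open import Data.Sum using (_⊎_)
open import Relation.Nullary using (¬_; does)
open import Relation.Binary.PropositionalEquality using (_≡_)
open import Relation.Binary.Construct.Closure.ReflexiveTransitive using (Star)

-- Graphs on vertex set Fin n, given by their GF(2) adjacency matrix A(G)
-- (GF(2) = Bool with xor / ∧).  The diagonal entry A v v is true iff v is
-- looped.  A graph is a symmetric such matrix.

Mat : ℕ → Set
Mat n = Fin n → Fin n → Bool

Symmetric : ∀ {n} → Mat n → Set
Symmetric {n} A = (x y : Fin n) → A x y ≡ A y x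

_==_ : ∀ {n} → Fin n → Fin n → Bool
x == y = does (x ≟ y)

sumFin : (n : ℕ) → (Fin n → ℕ) → ℕ
sumFin zero    f = 0
sumFin (suc n) f = f Fin.zero + sumFin n (λ i → f (Fin.suc i))

xorFin : (n : ℕ) → (Fin n → Bool) → Bool
xorFin zero    f = false
xorFin (suc n) f = f Fin.zero xor xorFin n (λ i → f (Fin.suc i))

count : ∀ {n} → (Fin n → Bool) → ℕ
count {n} p = sumFin n (λ i → if p i then 1 else 0)

isNbr : ∀ {n} → Mat n → Fin n → Fin n → Bool
isNbr A v w = not (w == v) ∧ A v w

degree : ∀ {n} → Mat n → Fin n → ℕ
degree A v = count (isNbr A v)

loopComp : ∀ {n} → Fin n → Mat n → Mat n
loopComp v A x y = if (x == v) ∧ (y == v) then not (A x y) else A x y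

simpleLC : ∀ {n} → Fin n → Mat n → Mat n
simpleLC v A x y =
  if isNbr A v x ∧ isNbr A v y ∧ not (x == y) then not (A x y) else A x y

nonSimpleLC : ∀ {n} → Fin n → Mat n → Mat n
nonSimpleLC v A x y =
  if isNbr A v x ∧ isNbr A v y then not (A x y) else A x y

data LCStep {n : ℕ} : Mat n → Mat n → Set where
  loop      : (v : Fin n) (A : Mat n) → LCStep A (loopComp v A)
  simple    : (v : Fin n) (A : Mat n) → LCStep A (simpleLC v A)
  nonSimple : (v : Fin n) (A : Mat n) → LCStep A (nonSimpleLC v A)

LocallyEquivalent : ∀ {n} → Mat n → Mat n → Set
LocallyEquivalent = Star LCStep

-- The binary matroid M[IAS(G)] represented by (I  A(G)  A(G)+I)

data Tag : Set where
  φ χ ψ : Tag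

-- element (t , v) stands for φ_G(v), χ_G(v), ψ_G(v) according to t
Elem : ℕ → Set
Elem n = Tag × Fin n

vertexOf : ∀ {n} → Elem n → Fin n
vertexOf (_ , v) = v

column : ∀ {n} → Mat n → Elem n → Fin n → Bool
column A (φ , v) i = i == v
column A (χ , v) i = A i v
column A (ψ , v) i = A i v xor (i == v)

ESet : ℕ → Set
ESet n = Elem n → Bool

_⊆_ : ∀ {n} → ESet n → ESet n → Set
U ⊆ S = ∀ w → U w ≡ true → S w ≡ true

complement : ∀ {n} → ESet n → ESet n
complement S w = not (S w)

full : ∀ {n} → ESet n
full _ = true

IsEmpty : ∀ {n} → ESet n → Set
IsEmpty U = ∀ w → U w ≡ false

SameSet : ∀ {n} → ESet n → ESet n → Set
SameSet U S = ∀ w → U w ≡ S w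

sumElem : ∀ {n} → (Elem n → ℕ) → ℕ
sumElem {n} f = sumFin n (λ v → f (φ , v) + f (χ , v) + f (ψ , v))

xorElem : ∀ {n} → (Elem n → Bool) → Bool
xorElem {n} f = xorFin n (λ v → f (φ , v) xor f (χ , v) xor f (ψ , v))

card : ∀ {n} → ESet n → ℕ
card U = sumElem (λ w → if U w then 1 else 0)

colSum : ∀ {n} → Mat n → ESet n → Fin n → Bool
colSum A U i = xorElem (λ w → U w ∧ column A w i)

Independent : ∀ {n} → Mat n → ESet n → Set
Independent A T =
  ∀ U → U ⊆ T → (∀ i → colSum A U i ≡ false) → IsEmpty U

IsRank : ∀ {n} → Mat n → ESet n → ℕ → Set
IsRank A S k =
  (Σ (ESet _) λ T → T ⊆ S × Independent A T × card T ≡ k)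
  × (∀ T → T ⊆ S → Independent A T → card T ≤ k)

IsCircuit : ∀ {n} → Mat n → ESet n → Set
IsCircuit A C =
  ¬ Independent A C × (∀ U → U ⊆ C → ¬ SameSet U C → Independent A U)

IsTransversal : ∀ {n} → ESet n → Set
IsTransversal {n} T = (v : Fin n) →
  ((if T (φ , v) then 1 else 0) + (if T (χ , v) then 1 else 0)
     + (if T (ψ , v) then 1 else 0)) ≡ 1

IsTransverseCircuit : ∀ {n} → Mat n → ESet n → Set
IsTransverseCircuit A C =
  IsCircuit A C × Σ (ESet _) λ T → IsTransversal T × C ⊆ T

tau : ∀ {n} → (Fin n → Bool) → ESet n
tau X w = X (vertexOf w)

-- S is a vertical k-separation: λ(S) < k and r(S), r(W-S) ≥ k, where
-- λ(S) = r(S) + r(W-S) - r(M)  (λ(S) < k  ⇔  r(S)+r(W-S) < k + r(M))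
VerticalSeparation : ∀ {n} → Mat n → ℕ → ESet n → Set
VerticalSeparation A k S =
  Σ ℕ λ a → Σ ℕ λ b → Σ ℕ λ r →
    IsRank A S a × IsRank A (complement S) b × IsRank A full r
    × a + b < k + r × k ≤ a × k ≤ b

KappaCandidate : ∀ {n} → Mat n → ℕ → Set
KappaCandidate A k =
  (Σ (ESet _) λ S → VerticalSeparation A k S) ⊎ IsRank A full k

IsKappa : ∀ {n} → Mat n → ℕ → Set
IsKappa A k = KappaCandidate A k × (∀ j → KappaCandidate A j → k ≤ j)

{-# OPTIONS --safe #-}

-- For q in GF(2)^n, the pair (A q , q) lists the coordinates of a kernel vector of (I A A+I) once each
-- triple φ, χ, ψ is read as the nonzero elements of GF(2)²; every kernel vector modulo the triples
-- arises so, and its support is the set of vertices where q or A q is nonzero.  Minimal supports are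
-- those of transverse circuits.  Local operations act on these vectors by automorphisms of the
-- coordinates, hence preserve supports, and a vector q = e_v has support of size degree v + 1; conversely
-- a vector can be moved to one with a single nonzero entry without enlarging its support.
-- By symmetry of A, q is also a linear functional on the columns whose values on the triple of v are
-- q v, (A q) v and their sum.  It kills all three elements or exactly one, so two nonzero functionals
-- whose kernels cover the matroid have disjoint supports: this is a vertical separation below n.
-- Finally, a vector whose support X has at most n/2 vertices has a disjoint companion, because the
-- conditions for y to have support off X form fewer independent equations than unknowns.

module Submission where

open import Defs
import Data.Bool as Bool
open import Data.Bool using (Bool; true; false; not; _∧_; _∨_; _xor_; if_then_else_)
open import Data.Bool.Properties using (¬-not; not-involutive; xor-same; xor-assoc; xor-comm; xor-identityʳ; ∧-assoc; ∧-comm; ∧-zeroʳ; ∧-identityʳ; ∧-distribˡ-xor; ∧-distribʳ-xor; ∨-zeroʳ; ∨-identityʳ)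
open import Data.Bool.Solver using (module xor-∧-Solver)
open import Data.Empty using (⊥; ⊥-elim)
open import Data.Fin using (Fin; _≟_)
open import Data.Fin.Properties using (any?; all?; suc-injective)
open import Data.Fin.Subset using (Subset)
open import Data.Fin.Subset.Properties using (anySubset?)
open import Data.Nat using (ℕ; zero; suc; _+_; _*_; _∸_; _≤_; _<_; z≤n; s≤s; z<s; s≤s⁻¹; _≤?_; _<?_) renaming (_≟_ to _≟ⁿ_)
open import Data.Nat.Properties hiding (_≟_; suc-injective)
open import Data.Nat.Solver using (module +-*-Solver)
open import Data.Product using (Σ; ∃; _×_; _,_; proj₁; proj₂)
open import Data.Sum using (inj₁; inj₂)
open import Data.Vec using (lookup; tabulate)
open import Data.Vec.Properties using (lookup∘tabulate)
open import Function using (_∘_; id)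
open import Function.Bundles using (_⇔_; mk⇔)
open import Relation.Binary.Construct.Closure.ReflexiveTransitive using (ε; _◅_)
open import Relation.Binary.Definitions using (DecidableEquality)
open import Relation.Binary.PropositionalEquality
open import Relation.Nullary using (¬_; Dec; yes; no; does; contradiction)
open import Relation.Nullary.Decidable using (dec-true; dec-false; map′; _×-dec_; _⊎-dec_; ¬?)

-- Parity sums and cardinalities over a finite index set.

_⊑_ : {I : Set} → (I → Bool) → (I → Bool) → Set
p ⊑ q = ∀ i → p i ≡ true → q i ≡ true

Inhabited : {I : Set} → (I → Bool) → Set
Inhabited p = ∃ λ i → p i ≡ true

true≢false : ∀ {b} → b ≡ true → b ≡ false → ⊥
true≢false p q with () ← trans (sym p) q

≢true⇒≡false : ∀ {b} → b ≢ true → b ≡ false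
≢true⇒≡false = ¬-not

∧-trueˡ : ∀ {a b} → a ∧ b ≡ true → a ≡ true
∧-trueˡ {true} _ = refl

∧-trueʳ : ∀ {a b} → a ∧ b ≡ true → b ≡ true
∧-trueʳ {true} p = p

∧-true : ∀ {a b} → a ≡ true → b ≡ true → a ∧ b ≡ true
∧-true refl refl = refl

xor≡false⇒≡ : ∀ {a b} → a xor b ≡ false → a ≡ b
xor≡false⇒≡ {true}  {true}  _ = refl
xor≡false⇒≡ {false} {false} _ = refl

-- Vertices and matroid elements both occur as indices of equations and of unknowns, so the linear
-- algebra is done once over an abstract finite index type. The fields are the laws from which the
-- rest follows without induction on that type.
record Summation (I : Set) : Set where
  infixl 20 _∖_
  field
    _≡?_ : DecidableEquality I
    ⨁    : (I → Bool) → Bool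
    ∥_∥  : (I → Bool) → ℕ

  _∖_ : (I → Bool) → I → I → Bool
  (p ∖ i) j = not (does (j ≡? i)) ∧ p j

  field
    inhabited?   : ∀ p → Dec (Inhabited p)
    ⨁-cong       : ∀ {f g} → (∀ i → f i ≡ g i) → ⨁ f ≡ ⨁ g
    ⨁-xor        : ∀ (f g : I → Bool) → ⨁ (λ i → f i xor g i) ≡ ⨁ f xor ⨁ g
    ⨁-single     : ∀ i {f} → (∀ j → j ≢ i → f j ≡ false) → ⨁ f ≡ f i
    ∥∥-mono      : ∀ {p q} → p ⊑ q → ∥ p ∥ ≤ ∥ q ∥
    ∥∥-remove    : ∀ {p i} → p i ≡ true → ∥ p ∥ ≡ suc ∥ p ∖ i ∥
    ∥∥-inhabited : ∀ {p} → 0 < ∥ p ∥ → Inhabited p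

  ⨁-vanish : ∀ {f} → (∀ i → f i ≡ false) → ⨁ f ≡ false
  ⨁-vanish {f} f≡0 = begin
    ⨁ f                     ≡⟨ ⨁-cong (λ i → trans (f≡0 i) (sym (xor-same (f i)))) ⟩
    ⨁ (λ i → f i xor f i)   ≡⟨ ⨁-xor f f ⟩
    ⨁ f xor ⨁ f             ≡⟨ xor-same (⨁ f) ⟩
    false                   ∎
    where open ≡-Reasoning

  ⨁-scale : ∀ c (f : I → Bool) → ⨁ (λ i → c ∧ f i) ≡ c ∧ ⨁ f
  ⨁-scale true  f = refl
  ⨁-scale false f = ⨁-vanish (λ _ → refl)

  ⨁-inhabited : ∀ {f} → ⨁ f ≡ true → Inhabited f
  ⨁-inhabited {f} sum≡1 with inhabited? f
  ... | yes i = i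
  ... | no ¬i = ⊥-elim (true≢false sum≡1 (⨁-vanish λ i → ≢true⇒≡false λ fi → ¬i (i , fi)))

  ∖-self : ∀ p i → (p ∖ i) i ≡ false
  ∖-self p i rewrite dec-true (i ≡? i) refl = refl

  ∖-other : ∀ p {i j} → j ≢ i → (p ∖ i) j ≡ p j
  ∖-other p {i} {j} j≢i rewrite dec-false (j ≡? i) j≢i = refl

  ∖-⊑ : ∀ p i → (p ∖ i) ⊑ p
  ∖-⊑ p i j = ∧-trueʳ

  ⊑-∖ : ∀ {p q} i → p ⊑ q → p i ≡ false → p ⊑ (q ∖ i)
  ⊑-∖ {p} {q} i p⊑q pi≡0 j pj = trans (∖-other q λ { refl → true≢false pj pi≡0 }) (p⊑q j pj)

  ∥∥-positive : ∀ {p} → Inhabited p → 0 < ∥ p ∥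
  ∥∥-positive (i , pi) = subst (0 <_) (sym (∥∥-remove pi)) z<s

  ∥∥-strict : ∀ {p q} i → p ⊑ q → p i ≡ false → q i ≡ true → ∥ p ∥ < ∥ q ∥
  ∥∥-strict {p} {q} i p⊑q pi qi =
    subst (∥ p ∥ <_) (sym (∥∥-remove qi)) (s≤s (∥∥-mono (⊑-∖ i p⊑q pi)))

  ⊑-antisym-∥∥ : ∀ {p q} → p ⊑ q → ∥ q ∥ ≤ ∥ p ∥ → ∀ i → p i ≡ q i
  ⊑-antisym-∥∥ {p} {q} p⊑q q≤p i with p i in pi | q i in qi
  ... | true  | true  = refl
  ... | false | false = refl
  ... | true  | false = ⊥-elim (true≢false (p⊑q i pi) qi)
  ... | false | true  = ⊥-elim (<⇒≱ (∥∥-strict i p⊑q pi qi) q≤p)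

  ⨁-remove : ∀ (f : I → Bool) i → ⨁ f ≡ ⨁ (f ∖ i) xor f i
  ⨁-remove f i = begin
    ⨁ f                                                  ≡⟨ ⨁-cong split ⟩
    ⨁ (λ j → (f ∖ i) j xor (does (j ≡? i) ∧ f j))        ≡⟨ ⨁-xor (f ∖ i) _ ⟩
    ⨁ (f ∖ i) xor ⨁ (λ j → does (j ≡? i) ∧ f j)          ≡⟨ cong (⨁ (f ∖ i) xor_) (⨁-single i off) ⟩
    ⨁ (f ∖ i) xor (does (i ≡? i) ∧ f i)                  ≡⟨ cong (λ b → ⨁ (f ∖ i) xor (b ∧ f i)) (dec-true (i ≡? i) refl) ⟩
    ⨁ (f ∖ i) xor f i                                    ∎
    where
    open ≡-Reasoning
    split : ∀ j → f j ≡ (f ∖ i) j xor (does (j ≡? i) ∧ f j)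
    split j with does (j ≡? i)
    ... | true  = refl
    ... | false = sym (xor-identityʳ (f j))
    off : ∀ j → j ≢ i → does (j ≡? i) ∧ f j ≡ false
    off j j≢i rewrite dec-false (j ≡? i) j≢i = refl

  -- Linearity at a single coordinate. It serves back-substitution in the elimination and, later,
  -- the effect of a flip on the image of a vector.
  ⨁-update : ∀ (f u : I → Bool) i c →
    ⨁ (λ j → f j ∧ (u j xor (does (j ≡? i) ∧ c))) ≡ ⨁ (λ j → f j ∧ u j) xor (f i ∧ c)
  ⨁-update f u i c = begin
    ⨁ (λ j → f j ∧ (u j xor (δ j ∧ c)))
      ≡⟨ ⨁-cong (λ j → ∧-distribˡ-xor (f j) (u j) (δ j ∧ c)) ⟩
    ⨁ (λ j → (f j ∧ u j) xor (f j ∧ (δ j ∧ c)))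
      ≡⟨ ⨁-xor (λ j → f j ∧ u j) (λ j → f j ∧ (δ j ∧ c)) ⟩
    ⨁ (λ j → f j ∧ u j) xor ⨁ (λ j → f j ∧ (δ j ∧ c))
      ≡⟨ cong (⨁ (λ j → f j ∧ u j) xor_) (⨁-single i off) ⟩
    ⨁ (λ j → f j ∧ u j) xor (f i ∧ (δ i ∧ c))
      ≡⟨ cong (λ b → ⨁ (λ j → f j ∧ u j) xor (f i ∧ (b ∧ c))) (dec-true (i ≡? i) refl) ⟩
    ⨁ (λ j → f j ∧ u j) xor (f i ∧ c) ∎
    where
    open ≡-Reasoning
    δ : I → Bool
    δ j = does (j ≡? i)
    off : ∀ j → j ≢ i → f j ∧ (δ j ∧ c) ≡ false
    off j j≢i rewrite dec-false (j ≡? i) j≢i = ∧-zeroʳ (f j)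

-- Homogeneous linear systems over GF(2).

module _ {I J : Set} (𝓘 : Summation I) (𝓙 : Summation J) where
  private
    module 𝓘 = Summation 𝓘
    module 𝓙 = Summation 𝓙
  open xor-∧-Solver

  NontrivialSolution : (J → Bool) → (I → Bool) → (J → I → Bool) → Set
  NontrivialSolution s t f =
    ∃ λ u → u ⊑ t × Inhabited u × (∀ j → s j ≡ true → 𝓘.⨁ (λ i → f j i ∧ u i) ≡ false)

  -- Gaussian elimination, by induction on a bound `k` for the number of equations: each round
  -- discards one equation and at most one unknown, so the unknowns stay in excess. The predicates
  -- `s` and `t` mark the active equations and unknowns, so the index types never change.
  homogeneous-solution : ∀ s t f → 𝓙.∥ s ∥ < 𝓘.∥ t ∥ → NontrivialSolution s t f
  homogeneous-solution s t f s<t = go 𝓙.∥ s ∥ s t f ≤-refl s<t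
    where
    go : ∀ k s t f → 𝓙.∥ s ∥ ≤ k → k < 𝓘.∥ t ∥ → NontrivialSolution s t f
    go zero s t f s≤0 0<t =
      t , (λ _ → id) , 𝓘.∥∥-inhabited 0<t ,
      λ j sj → ⊥-elim (n≮0 (<-≤-trans (𝓙.∥∥-positive (j , sj)) s≤0))
    go (suc k) s t f s≤k k<t with 𝓙.inhabited? s
    ... | no ∄s = t , (λ _ → id) , 𝓘.∥∥-inhabited (≤-<-trans z≤n k<t) , λ j sj → ⊥-elim (∄s (j , sj))
    ... | yes (j₀ , sj₀) with 𝓘.inhabited? (λ i → f j₀ i ∧ t i)
    -- No active unknown occurs in equation `j₀`, so it holds for every `u` inside `t` and is
    -- dropped alone.
    ...   | no ∄pivot with go k (s 𝓙.∖ j₀) t f (s≤s⁻¹ (subst (_≤ suc k) (𝓙.∥∥-remove sj₀) s≤k)) (<-trans (n<1+n k) k<t)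
    ...     | u , u⊑t , u≢0 , sol = u , u⊑t , u≢0 , sol′
      where
      sol′ : ∀ j → s j ≡ true → 𝓘.⨁ (λ i → f j i ∧ u i) ≡ false
      sol′ j sj with j 𝓙.≡? j₀
      ... | no j≢ = sol j (trans (𝓙.∖-other s j≢) sj)
      ... | yes refl = 𝓘.⨁-vanish λ i → ≢true⇒≡false λ fu →
        ∄pivot (i , ∧-true (∧-trueˡ fu) (u⊑t i (∧-trueʳ {f j i} fu)))
    go (suc k) s t f s≤k k<t | yes (j₀ , sj₀) | yes (i₀ , pivot)
      -- Adding `f j i₀` times equation `j₀` to equation `j` clears the coefficient of the pivot
      -- unknown `i₀`.
      with go k (s 𝓙.∖ j₀) (t 𝓘.∖ i₀) (λ j i → f j i xor (f j i₀ ∧ f j₀ i))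
             (s≤s⁻¹ (subst (_≤ suc k) (𝓙.∥∥-remove sj₀) s≤k))
             (s≤s⁻¹ (subst (suc k <_) (𝓘.∥∥-remove (∧-trueʳ {f j₀ i₀} pivot)) k<t))
    ... | u , u⊑ , (i₁ , ui₁) , sol = u′ , u′⊑t , (i₁ , u′i₁) , sol′
      where
      c : Bool
      c = 𝓘.⨁ (λ i → f j₀ i ∧ u i)
      -- Back-substitution: `u` vanishes at `i₀`, and `c` is the value there that makes equation
      -- `j₀` hold.
      u′ : I → Bool
      u′ i = u i xor (does (i 𝓘.≡? i₀) ∧ c)
      u′-other : ∀ {i} → i ≢ i₀ → u′ i ≡ u i
      u′-other {i} i≢ rewrite dec-false (i 𝓘.≡? i₀) i≢ = xor-identityʳ (u i)
      u′⊑t : u′ ⊑ t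
      u′⊑t i u′i with i 𝓘.≡? i₀
      ... | yes refl = ∧-trueʳ {f j₀ i} pivot
      ... | no _ = 𝓘.∖-⊑ t i₀ i (u⊑ i (trans (sym (xor-identityʳ (u i))) u′i))
      u′i₁ : u′ i₁ ≡ true
      u′i₁ = trans (u′-other λ { refl → true≢false (u⊑ i₁ ui₁) (𝓘.∖-self t i₁) }) ui₁
      expand : ∀ j → 𝓘.⨁ (λ i → f j i ∧ u′ i) ≡ 𝓘.⨁ (λ i → (f j i xor (f j i₀ ∧ f j₀ i)) ∧ u i)
      expand j = begin
        𝓘.⨁ (λ i → f j i ∧ u′ i)
          ≡⟨ 𝓘.⨁-update (f j) u i₀ c ⟩
        𝓘.⨁ (λ i → f j i ∧ u i) xor (f j i₀ ∧ c)
          ≡⟨ cong (𝓘.⨁ (λ i → f j i ∧ u i) xor_) (sym (𝓘.⨁-scale (f j i₀) _)) ⟩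
        𝓘.⨁ (λ i → f j i ∧ u i) xor 𝓘.⨁ (λ i → f j i₀ ∧ (f j₀ i ∧ u i))
          ≡⟨ sym (𝓘.⨁-xor _ _) ⟩
        𝓘.⨁ (λ i → (f j i ∧ u i) xor (f j i₀ ∧ (f j₀ i ∧ u i)))
          ≡⟨ 𝓘.⨁-cong (λ i → solve 4 (λ a b d v → (a :* v) :+ (b :* (d :* v)) := (a :+ (b :* d)) :* v) refl
                                (f j i) (f j i₀) (f j₀ i) (u i)) ⟩
        𝓘.⨁ (λ i → (f j i xor (f j i₀ ∧ f j₀ i)) ∧ u i) ∎
        where open ≡-Reasoning
      sol′ : ∀ j → s j ≡ true → 𝓘.⨁ (λ i → f j i ∧ u′ i) ≡ false
      sol′ j sj with j 𝓙.≡? j₀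
      ... | no j≢ = trans (expand j) (sol j (trans (𝓙.∖-other s j≢) sj))
      -- The reduced form of equation `j₀` itself is identically zero, because its pivot coefficient
      -- is 1.
      ... | yes refl = trans (expand j) (𝓘.⨁-vanish λ i → cancel (f j i))
        where
        cancel : ∀ a {v} → (a xor (f j i₀ ∧ a)) ∧ v ≡ false
        cancel a rewrite ∧-trueˡ {f j i₀} pivot | xor-same a = refl

-- Sums and counts over vertices and over matroid elements.

==-refl : ∀ {n} (x : Fin n) → (x == x) ≡ true
==-refl x = dec-true (x ≟ x) refl

==-≢ : ∀ {n} {x y : Fin n} → x ≢ y → (x == y) ≡ false
==-≢ {x = x} {y} = dec-false (x ≟ y)

xorFin-cong : ∀ n {f g : Fin n → Bool} → (∀ i → f i ≡ g i) → xorFin n f ≡ xorFin n g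
xorFin-cong zero    f≗g = refl
xorFin-cong (suc n) f≗g = cong₂ _xor_ (f≗g Fin.zero) (xorFin-cong n (f≗g ∘ Fin.suc))

interchange : ∀ a b c d → (a xor b) xor (c xor d) ≡ (a xor c) xor (b xor d)
interchange = solve 4 (λ a b c d → (a :+ b) :+ (c :+ d) := (a :+ c) :+ (b :+ d)) refl
  where open xor-∧-Solver

xorFin-xor : ∀ n (f g : Fin n → Bool) → xorFin n (λ i → f i xor g i) ≡ xorFin n f xor xorFin n g
xorFin-xor zero    f g = refl
xorFin-xor (suc n) f g = trans
  (cong ((f Fin.zero xor g Fin.zero) xor_) (xorFin-xor n (f ∘ Fin.suc) (g ∘ Fin.suc)))
  (interchange (f Fin.zero) (g Fin.zero) _ _)

xorFin-vanish : ∀ n {f : Fin n → Bool} → (∀ i → f i ≡ false) → xorFin n f ≡ false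
xorFin-vanish zero    f≡0 = refl
xorFin-vanish (suc n) f≡0 = cong₂ _xor_ (f≡0 Fin.zero) (xorFin-vanish n (f≡0 ∘ Fin.suc))

xorFin-single : ∀ n i {f : Fin n → Bool} → (∀ j → j ≢ i → f j ≡ false) → xorFin n f ≡ f i
xorFin-single (suc n) Fin.zero {f} off =
  trans (cong (f Fin.zero xor_) (xorFin-vanish n (λ j → off (Fin.suc j) λ ()))) (xor-identityʳ _)
xorFin-single (suc n) (Fin.suc i) off = cong₂ _xor_ (off Fin.zero λ ())
  (xorFin-single n i λ j j≢i → off (Fin.suc j) (j≢i ∘ suc-injective))

sumFin-mono : ∀ n {f g : Fin n → ℕ} → (∀ i → f i ≤ g i) → sumFin n f ≤ sumFin n g
sumFin-mono zero    f≤g = z≤n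
sumFin-mono (suc n) f≤g = +-mono-≤ (f≤g Fin.zero) (sumFin-mono n (f≤g ∘ Fin.suc))

sumFin-cong : ∀ n {f g : Fin n → ℕ} → (∀ i → f i ≡ g i) → sumFin n f ≡ sumFin n g
sumFin-cong zero    f≗g = refl
sumFin-cong (suc n) f≗g = cong₂ _+_ (f≗g Fin.zero) (sumFin-cong n (f≗g ∘ Fin.suc))

sumFin-suc : ∀ n i {f g : Fin n → ℕ} → f i ≡ suc (g i) → (∀ j → j ≢ i → f j ≡ g j) →
  sumFin n f ≡ suc (sumFin n g)
sumFin-suc (suc n) Fin.zero    fi off = cong₂ _+_ fi (sumFin-cong n λ j → off (Fin.suc j) λ ())
sumFin-suc (suc n) (Fin.suc i) {f} {g} fi off = trans
  (cong₂ _+_ (off Fin.zero λ ()) (sumFin-suc n i fi λ j j≢i → off (Fin.suc j) (j≢i ∘ suc-injective)))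
  (+-suc (g Fin.zero) _)

sumFin-positive : ∀ n {f : Fin n → ℕ} → 0 < sumFin n f → ∃ λ i → 0 < f i
sumFin-positive (suc n) {f} 0<Σ with f Fin.zero in f0
... | suc _ = Fin.zero , subst (0 <_) (sym f0) z<s
... | zero with sumFin-positive n 0<Σ
...   | i , 0<fi = Fin.suc i , 0<fi

sumFin-const : ∀ n c → sumFin n (λ _ → c) ≡ n * c
sumFin-const zero    c = refl
sumFin-const (suc n) c = cong (c +_) (sumFin-const n c)

sumFin-+ : ∀ n (f g : Fin n → ℕ) → sumFin n (λ i → f i + g i) ≡ sumFin n f + sumFin n g
sumFin-+ zero    f g = refl
sumFin-+ (suc n) f g = trans (cong (f Fin.zero + g Fin.zero +_) (sumFin-+ n _ _))
  (solve 4 (λ a b c d → (a :+ b) :+ (c :+ d) := (a :+ c) :+ (b :+ d)) refl (f Fin.zero) (g Fin.zero) _ _)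
  where open +-*-Solver

⟦_⟧ : Bool → ℕ
⟦ b ⟧ = if b then 1 else 0

⟦⟧-mono : ∀ {a b} → (a ≡ true → b ≡ true) → ⟦ a ⟧ ≤ ⟦ b ⟧
⟦⟧-mono {false}        _   = z≤n
⟦⟧-mono {true} {true}  _   = ≤-refl
⟦⟧-mono {true} {false} a⇒b with () ← a⇒b refl

⟦⟧-positive : ∀ {b} → 0 < ⟦ b ⟧ → b ≡ true
⟦⟧-positive {true} _ = refl

finSummation : ∀ n → Summation (Fin n)
finSummation n = record
  { _≡?_         = _≟_
  ; ⨁            = xorFin n
  ; ∥_∥          = count
  ; inhabited?   = λ p → any? (λ i → p i Bool.≟ true)
  ; ⨁-cong       = xorFin-cong n
  ; ⨁-xor        = xorFin-xor n
  ; ⨁-single     = xorFin-single n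
  ; ∥∥-mono      = λ p⊑q → sumFin-mono n (λ i → ⟦⟧-mono (p⊑q i))
  ; ∥∥-remove    = λ {p} {i} pi → sumFin-suc n i
      (trans (cong ⟦_⟧ pi) (cong (λ b → suc ⟦ not b ∧ p i ⟧) (sym (==-refl i))))
      (λ j j≢i → cong (λ b → ⟦ not b ∧ p j ⟧) (sym (==-≢ j≢i)))
  ; ∥∥-inhabited = λ 0<p → let i , 0<pi = sumFin-positive n 0<p in i , ⟦⟧-positive 0<pi
  }

_≟ᵗ_ : DecidableEquality Tag
φ ≟ᵗ φ = yes refl
φ ≟ᵗ χ = no λ ()
φ ≟ᵗ ψ = no λ ()
χ ≟ᵗ φ = no λ ()
χ ≟ᵗ χ = yes refl
χ ≟ᵗ ψ = no λ ()
ψ ≟ᵗ φ = no λ ()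
ψ ≟ᵗ χ = no λ ()
ψ ≟ᵗ ψ = yes refl

_≟ᵉ_ : ∀ {n} → DecidableEquality (Elem n)
(s , v) ≟ᵉ (t , w) = map′ (λ { (refl , refl) → refl }) (λ { refl → refl , refl }) (s ≟ᵗ t ×-dec v ≟ w)

inhabitedElem? : ∀ {n} (p : ESet n) → Dec (Inhabited p)
inhabitedElem? p = map′
  (λ { (v , inj₁ pφ) → (φ , v) , pφ ; (v , inj₂ (inj₁ pχ)) → (χ , v) , pχ ; (v , inj₂ (inj₂ pψ)) → (ψ , v) , pψ })
  (λ { ((φ , v) , pφ) → v , inj₁ pφ ; ((χ , v) , pχ) → v , inj₂ (inj₁ pχ) ; ((ψ , v) , pψ) → v , inj₂ (inj₂ pψ) })
  (any? λ v → (p (φ , v) Bool.≟ true) ⊎-dec (p (χ , v) Bool.≟ true) ⊎-dec (p (ψ , v) Bool.≟ true))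

xorElem-cong : ∀ {n} {f g : Elem n → Bool} → (∀ w → f w ≡ g w) → xorElem f ≡ xorElem g
xorElem-cong {n} f≗g = xorFin-cong n λ v →
  cong₂ _xor_ (f≗g (φ , v)) (cong₂ _xor_ (f≗g (χ , v)) (f≗g (ψ , v)))

xorElem-xor : ∀ {n} (f g : Elem n → Bool) → xorElem (λ w → f w xor g w) ≡ xorElem f xor xorElem g
xorElem-xor {n} f g = trans
  (xorFin-cong n λ v → solve 6
    (λ a b c d e h → (a :+ b) :+ ((c :+ d) :+ (e :+ h)) := (a :+ (c :+ e)) :+ (b :+ (d :+ h))) refl
    (f (φ , v)) (g (φ , v)) (f (χ , v)) (g (χ , v)) (f (ψ , v)) (g (ψ , v)))
  (xorFin-xor n _ _)
  where open xor-∧-Solver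

xorElem-single : ∀ {n} (w : Elem n) {f} → (∀ u → u ≢ w → f u ≡ false) → xorElem f ≡ f w
xorElem-single {n} (t , v) {f} off = trans (xorFin-single n v λ u u≢v →
    cong₂ _xor_ (off _ (u≢v ∘ cong proj₂)) (cong₂ _xor_ (off _ (u≢v ∘ cong proj₂)) (off _ (u≢v ∘ cong proj₂))))
  (at t off)
  where
  at : ∀ t → (∀ u → u ≢ (t , v) → f u ≡ false) → f (φ , v) xor (f (χ , v) xor f (ψ , v)) ≡ f (t , v)
  at φ off rewrite off (χ , v) (λ ()) | off (ψ , v) (λ ()) = xor-identityʳ _
  at χ off rewrite off (φ , v) (λ ()) | off (ψ , v) (λ ()) = xor-identityʳ _
  at ψ off rewrite off (φ , v) (λ ()) | off (χ , v) (λ ()) = refl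

card-remove : ∀ {n} {p : ESet n} {w} → p w ≡ true →
  card p ≡ suc (card (λ u → not (does (u ≟ᵉ w)) ∧ p u))
card-remove {n} {p} {t , v} pw = sumFin-suc n v (at t pw) λ u u≢v →
  cong₂ _+_ (cong₂ _+_ (keep φ u≢v) (keep χ u≢v)) (keep ψ u≢v)
  where
  keep : ∀ s {u} → u ≢ v → ⟦ p (s , u) ⟧ ≡ ⟦ not (does ((s , u) ≟ᵉ (t , v))) ∧ p (s , u) ⟧
  keep s {u} u≢v = cong (λ b → ⟦ not b ∧ p (s , u) ⟧) (sym (dec-false ((s , u) ≟ᵉ (t , v)) (u≢v ∘ cong proj₂)))
  at : ∀ t → p (t , v) ≡ true → let r = λ s → ⟦ not (does ((s , v) ≟ᵉ (t , v))) ∧ p (s , v) ⟧ in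
    ⟦ p (φ , v) ⟧ + ⟦ p (χ , v) ⟧ + ⟦ p (ψ , v) ⟧ ≡ suc (r φ + r χ + r ψ)
  at φ pw rewrite ==-refl v | pw = refl
  at χ pw rewrite ==-refl v | pw | +-suc ⟦ p (φ , v) ⟧ 0 = refl
  at ψ pw rewrite ==-refl v | pw | +-suc (⟦ p (φ , v) ⟧ + ⟦ p (χ , v) ⟧) 0 = refl

card-inhabited : ∀ {n} {p : ESet n} → 0 < card p → Inhabited p
card-inhabited {n} {p} 0<p with sumFin-positive n 0<p
... | v , 0<v with p (φ , v) in pφ | p (χ , v) in pχ | p (ψ , v) in pψ
...   | true  | _     | _    = (φ , v) , pφ
...   | false | true  | _    = (χ , v) , pχ
...   | false | false | true = (ψ , v) , pψ

elemSummation : ∀ n → Summation (Elem n)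
elemSummation n = record
  { _≡?_         = _≟ᵉ_
  ; ⨁            = xorElem
  ; ∥_∥          = card
  ; inhabited?   = inhabitedElem?
  ; ⨁-cong       = xorElem-cong
  ; ⨁-xor        = xorElem-xor
  ; ⨁-single     = xorElem-single
  ; ∥∥-mono      = λ p⊑q → sumFin-mono n λ v →
      +-mono-≤ (+-mono-≤ (⟦⟧-mono (p⊑q (φ , v))) (⟦⟧-mono (p⊑q (χ , v)))) (⟦⟧-mono (p⊑q (ψ , v)))
  ; ∥∥-remove    = λ {p} → card-remove {p = p}
  ; ∥∥-inhabited = card-inhabited
  }

⨁-xorFin : {I : Set} (𝓘 : Summation I) → ∀ n (g : I → Fin n → Bool) →
  Summation.⨁ 𝓘 (λ i → xorFin n (g i)) ≡ xorFin n (λ j → Summation.⨁ 𝓘 (λ i → g i j))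
⨁-xorFin 𝓘 zero    g = Summation.⨁-vanish 𝓘 λ _ → refl
⨁-xorFin 𝓘 (suc n) g = trans (Summation.⨁-xor 𝓘 _ _)
  (cong (Summation.⨁ 𝓘 (λ i → g i Fin.zero) xor_) (⨁-xorFin 𝓘 n (λ i → g i ∘ Fin.suc)))

-- Vectors, their supports, and local operations.

∨-false : ∀ {a b} → a ∨ b ≡ false → a ≡ false × b ≡ false
∨-false {false} {false} _ = refl , refl

not-true : ∀ {a} → not a ≡ true → a ≡ false
not-true {false} _ = refl

module _ {n : ℕ} where
  private module F = Summation (finSummation n)

  img : Mat n → (Fin n → Bool) → Fin n → Bool
  img A q x = xorFin n (λ y → A x y ∧ q y)

  supp : Mat n → (Fin n → Bool) → Fin n → Bool
  supp A q x = q x ∨ img A q x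

  nbrSum : Mat n → Fin n → (Fin n → Bool) → Bool
  nbrSum A v q = xorFin n (λ y → isNbr A v y ∧ q y)

  supp-off : ∀ A q x → supp A q x ≡ false → q x ≡ false × img A q x ≡ false
  supp-off A q x = ∨-false

  ⊑-by-false : ∀ {p q : Fin n → Bool} → (∀ x → q x ≡ false → p x ≡ false) → p ⊑ q
  ⊑-by-false q⇒p x px = ¬-not λ qx → true≢false px (q⇒p x qx)

  isNbr-self : ∀ (A : Mat n) v → isNbr A v v ≡ false
  isNbr-self A v = F.∖-self (A v) v

  isNbr-other : ∀ (A : Mat n) {v x} → x ≢ v → isNbr A v x ≡ A v x
  isNbr-other A {v} = F.∖-other (A v)

  isNbr-sym : ∀ {A : Mat n} → Symmetric A → ∀ v w → isNbr A v w ≡ isNbr A w v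
  isNbr-sym {A} sym-A v w with v ≟ w
  ... | yes refl = isNbr-self A v
  ... | no v≢w = trans (isNbr-other A (v≢w ∘ sym)) (sym-A v w)

  img-nbrSum : ∀ A q v → img A q v ≡ nbrSum A v q xor (A v v ∧ q v)
  img-nbrSum A q v = trans (F.⨁-remove (λ y → A v y ∧ q y) v)
    (cong (_xor (A v v ∧ q v)) (F.⨁-cong λ y → sym (∧-assoc (not (y == v)) (A v y) (q y))))

  -- The loop term in `img-nbrSum` carries the factor `q v`, which vanishes off the support; so the
  -- parity equals `img A q v`, whether or not `v` is looped.
  nbrSum-off : ∀ A q v → supp A q v ≡ false → nbrSum A v q ≡ false
  nbrSum-off A q v sv = begin
    nbrSum A v q                     ≡⟨ sym (xor-identityʳ _) ⟩
    nbrSum A v q xor false           ≡⟨ cong (nbrSum A v q xor_) (sym (trans (cong (A v v ∧_) (proj₁ off)) (∧-zeroʳ (A v v)))) ⟩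
    nbrSum A v q xor (A v v ∧ q v)   ≡⟨ sym (img-nbrSum A q v) ⟩
    img A q v                        ≡⟨ proj₂ off ⟩
    false                            ∎
    where
    open ≡-Reasoning
    off = supp-off A q v sv

  img-xor : ∀ {A A′ : Mat n} {D : Mat n} q x → (∀ y → A′ x y ≡ A x y xor D x y) →
    img A′ q x ≡ img A q x xor img D q x
  img-xor {A} {A′} {D} q x A′≡ = trans
    (F.⨁-cong λ y → trans (cong (_∧ q y) (A′≡ y)) (∧-distribʳ-xor (q y) (A x y) (D x y)))
    (F.⨁-xor _ _)

  -- The matrix gains the rank-one term `N Nᵀ`, where `N` is the neighbourhood of `v`. The entrywise
  -- form, unlike an equation with `nonSimpleLC`, can also be read backwards from `A′` to `A`.
  IsLocalComplement : Fin n → Mat n → Mat n → Set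
  IsLocalComplement v A A′ = ∀ x y → A′ x y ≡ A x y xor (isNbr A v x ∧ isNbr A v y)

  -- A relation, so that a vector with even parity at `v` can count as its own flip; `flip` is the
  -- canonical instance.
  IsFlip : Mat n → Fin n → (Fin n → Bool) → (Fin n → Bool) → Set
  IsFlip A v q q′ = ∀ x → q′ x ≡ q x xor ((x == v) ∧ nbrSum A v q)

  flip : Mat n → Fin n → (Fin n → Bool) → Fin n → Bool
  flip A v q x = q x xor ((x == v) ∧ nbrSum A v q)

  -- With `s = nbrSum A v q`, the term `N Nᵀ` contributes `s N`, and the change of `q` at `v`
  -- contributes `s` times column `v`, which by symmetry is `N` plus the loop entry. The two copies
  -- of `s N` cancel; only the loop entry remains.
  lc-img : ∀ {A A′ v q q′} → Symmetric A → IsLocalComplement v A A′ → IsFlip A v q q′ →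
    ∀ x → img A′ q′ x ≡ img A q x xor ((x == v) ∧ (A v v ∧ nbrSum A v q))
  lc-img {A} {A′} {v} {q} {q′} sym-A lc fl x = begin
    img A′ q′ x
      ≡⟨ F.⨁-cong (λ y → cong (A′ x y ∧_) (fl y)) ⟩
    xorFin n (λ y → A′ x y ∧ (q y xor ((y == v) ∧ s)))
      ≡⟨ F.⨁-update (A′ x) q v s ⟩
    img A′ q x xor (A′ x v ∧ s)
      ≡⟨ cong₂ _xor_ (img-xor {A} {A′} {λ x y → isNbr A v x ∧ isNbr A v y} q x (lc x)) (cong (_∧ s) A′xv) ⟩
    (img A q x xor xorFin n (λ y → (isNbr A v x ∧ isNbr A v y) ∧ q y)) xor (A x v ∧ s)
      ≡⟨ cong (λ b → (img A q x xor b) xor (A x v ∧ s))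
           (trans (F.⨁-cong λ y → ∧-assoc (isNbr A v x) (isNbr A v y) (q y)) (F.⨁-scale (isNbr A v x) _)) ⟩
    (img A q x xor (isNbr A v x ∧ s)) xor (A x v ∧ s)
      ≡⟨ collect ⟩
    img A q x xor ((x == v) ∧ (A v v ∧ s)) ∎
    where
    open ≡-Reasoning
    s : Bool
    s = nbrSum A v q
    A′xv : A′ x v ≡ A x v
    A′xv rewrite lc x v | isNbr-self A v | ∧-zeroʳ (isNbr A v x) = xor-identityʳ (A x v)
    collect : (img A q x xor (isNbr A v x ∧ s)) xor (A x v ∧ s) ≡ img A q x xor ((x == v) ∧ (A v v ∧ s))
    collect with x ≟ v
    ... | yes refl = cong (_xor (A x x ∧ s)) (xor-identityʳ (img A q x))
    ... | no _ rewrite sym-A v x = trans (xor-assoc (img A q x) (A x v ∧ s) (A x v ∧ s))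
      (cong (img A q x xor_) (xor-same (A x v ∧ s)))

  -- Vector and image change only at `v`, by multiples of the neighbour parity, and that parity is 0
  -- when `v` is off the support.
  lc-supp : ∀ {A A′ v q q′} → Symmetric A → IsLocalComplement v A A′ → IsFlip A v q q′ →
    supp A′ q′ ⊑ supp A q
  lc-supp {A} {A′} {v} {q} {q′} sym-A lc fl = ⊑-by-false off
    where
    off : ∀ x → supp A q x ≡ false → supp A′ q′ x ≡ false
    off x sx = cong₂ _∨_
      (trans (fl x) (cong₂ _xor_ (proj₁ (supp-off A q x sx)) (proj₁ change)))
      (trans (lc-img {q = q} {q′} sym-A lc fl x) (cong₂ _xor_ (proj₂ (supp-off A q x sx)) (proj₂ change)))
      where
      change : (x == v) ∧ nbrSum A v q ≡ false × (x == v) ∧ (A v v ∧ nbrSum A v q) ≡ false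
      change with x ≟ v
      ... | no _     = refl , refl
      ... | yes refl = s≡0 , trans (cong (A x x ∧_) s≡0) (∧-zeroʳ (A x x))
        where s≡0 = nbrSum-off A q x sx

  -- The entry at `v` changes only if the parity is odd; then some neighbour of `v`, hence a vertex
  -- other than `v`, has entry 1 and keeps it.
  flip-inhabited : ∀ {A v q} → Inhabited q → Inhabited (flip A v q)
  flip-inhabited {A} {v} {q} (x , qx) with nbrSum A v q in s≡
  ... | false = x , trans (cong (q x xor_) (∧-zeroʳ (x == v))) (trans (xor-identityʳ (q x)) qx)
  ... | true with F.⨁-inhabited s≡
  ...   | y , Ny∧qy = y , trans (cong (λ b → q y xor (b ∧ true)) (==-≢ y≢v)) (trans (xor-identityʳ (q y)) (∧-trueʳ {isNbr A v y} Ny∧qy))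
    where
    y≢v : y ≢ v
    y≢v refl = true≢false (∧-trueˡ {isNbr A v y} Ny∧qy) (isNbr-self A v)

  lc-isNbr : ∀ {A A′ v} → IsLocalComplement v A A′ → ∀ x → isNbr A′ v x ≡ isNbr A v x
  lc-isNbr {A} {A′} {v} lc x rewrite lc v x | isNbr-self A v = cong (not (x == v) ∧_) (xor-identityʳ (A v x))

  -- Complementing at `v` leaves the neighbourhood of `v` alone, so the same term is added twice and
  -- cancels.
  lc-inverse : ∀ {A A′ v} → IsLocalComplement v A A′ → IsLocalComplement v A′ A
  lc-inverse {A} {A′} {v} lc x y
    rewrite lc-isNbr {A} {A′} lc x | lc-isNbr {A} {A′} lc y | lc x y =
    sym (trans (xor-assoc (A x y) N N) (trans (cong (A x y xor_) (xor-same N)) (xor-identityʳ (A x y))))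
    where
    N : Bool
    N = isNbr A v x ∧ isNbr A v y

  lc-symmetric : ∀ {A A′ v} → Symmetric A → IsLocalComplement v A A′ → Symmetric A′
  lc-symmetric {A} {A′} {v} sym-A lc x y =
    trans (lc x y) (trans (cong₂ _xor_ (sym-A x y) (∧-comm (isNbr A v x) (isNbr A v y))) (sym (lc y x)))

  IsDiagonalChange : (Fin n → Bool) → Mat n → Mat n → Set
  IsDiagonalChange d A A′ = ∀ x y → A′ x y ≡ A x y xor ((x == y) ∧ d x)

  diagonal-symmetric : ∀ {d A A′} → Symmetric A → IsDiagonalChange d A A′ → Symmetric A′
  diagonal-symmetric {d} {A} {A′} sym-A dc x y with x ≟ y
  ... | yes refl = refl
  ... | no x≢y rewrite dc x y | dc y x | ==-≢ x≢y | ==-≢ (x≢y ∘ sym) | sym-A x y = refl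

  -- The image at `x` changes by `d x ∧ q x`, which is 0 wherever `q` vanishes.
  diagonal-supp : ∀ {d A A′ q} → IsDiagonalChange d A A′ → supp A q ⊑ supp A′ q
  diagonal-supp {d} {A} {A′} {q} dc = ⊑-by-false off
    where
    img-diagonal : ∀ x → img A′ q x ≡ img A q x xor (d x ∧ q x)
    img-diagonal x = trans (img-xor {A} {A′} {λ x y → (x == y) ∧ d x} q x (dc x))
      (cong (img A q x xor_) (trans
        (F.⨁-single x λ y y≢x → cong (λ b → (b ∧ d x) ∧ q y) (==-≢ (y≢x ∘ sym)))
        (cong (λ b → (b ∧ d x) ∧ q x) (==-refl x))))
    off : ∀ x → supp A′ q x ≡ false → supp A q x ≡ false
    off x sx with supp-off A′ q x sx
    ... | qx , ix rewrite img-diagonal x | qx | ∧-zeroʳ (d x) | xor-identityʳ (img A q x) = ix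

  nonSimpleLC-isLC : ∀ v (A : Mat n) → IsLocalComplement v A (nonSimpleLC v A)
  nonSimpleLC-isLC v A x y with isNbr A v x ∧ isNbr A v y
  ... | true  = xor-comm true (A x y)
  ... | false = sym (xor-identityʳ (A x y))

  loopComp-isDiagonal : ∀ v (A : Mat n) → IsDiagonalChange (_== v) A (loopComp v A)
  loopComp-isDiagonal v A x y with x ≟ y
  loopComp-isDiagonal v A x y | yes refl with x ≟ v
  ... | yes refl = xor-comm true (A x x)
  ... | no _ = sym (xor-identityʳ (A x x))
  loopComp-isDiagonal v A x y | no x≢y with x ≟ v | y ≟ v
  ... | yes refl | yes refl = contradiction refl x≢y
  ... | yes refl | no _     = sym (xor-identityʳ (A x y))
  ... | no _     | _        = sym (xor-identityʳ (A x y))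

  -- Reduces the simple complement to the non-simple one followed by loop changes at the neighbours
  -- of `v`.
  simpleLC-isDiagonal : ∀ v (A : Mat n) → IsDiagonalChange (isNbr A v) (nonSimpleLC v A) (simpleLC v A)
  simpleLC-isDiagonal v A x y with x ≟ y
  simpleLC-isDiagonal v A x y | no _ with isNbr A v x | isNbr A v y
  ... | true  | true  = sym (xor-identityʳ (not (A x y)))
  ... | true  | false = sym (xor-identityʳ (A x y))
  ... | false | _     = sym (xor-identityʳ (A x y))
  simpleLC-isDiagonal v A x y | yes refl with isNbr A v x
  ... | true  = sym (trans (xor-comm (not (A x x)) true) (not-involutive (A x x)))
  ... | false = sym (xor-identityʳ (A x x))

  HasWeight≤ : ℕ → Mat n → Set
  HasWeight≤ k A = ∃ λ q → Inhabited q × count (supp A q) ≤ k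

  lc-weight : ∀ {A A′ v k} → Symmetric A → IsLocalComplement v A A′ → HasWeight≤ k A → HasWeight≤ k A′
  lc-weight {A} {v = v} sym-A lc (q , q≢0 , q≤k) =
    flip A v q , flip-inhabited {A} {v} {q} q≢0 , ≤-trans (F.∥∥-mono (lc-supp {q = q} sym-A lc λ _ → refl)) q≤k

  diagonal-weight : ∀ {d A A′ k} → IsDiagonalChange d A A′ → HasWeight≤ k A′ → HasWeight≤ k A
  diagonal-weight dc (q , q≢0 , q≤k) = q , q≢0 , ≤-trans (F.∥∥-mono (diagonal-supp {q = q} dc)) q≤k

  step-symmetric : ∀ {A B : Mat n} → LCStep A B → Symmetric A → Symmetric B
  step-symmetric (loop v A)      sym-A = diagonal-symmetric sym-A (loopComp-isDiagonal v A)
  step-symmetric (nonSimple v A) sym-A = lc-symmetric sym-A (nonSimpleLC-isLC v A)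
  step-symmetric (simple v A)    sym-A =
    diagonal-symmetric (lc-symmetric sym-A (nonSimpleLC-isLC v A)) (simpleLC-isDiagonal v A)

  -- Vectors are pulled back along a step, so that a vertex of small degree at the end of a chain
  -- yields a light vector for the initial graph. Complements are undone by `lc-inverse`.
  step-weight : ∀ {A B k} → LCStep A B → Symmetric A → HasWeight≤ k B → HasWeight≤ k A
  step-weight (loop v A)      sym-A = diagonal-weight (loopComp-isDiagonal v A)
  step-weight (nonSimple v A) sym-A = lc-weight (lc-symmetric sym-A lc) (lc-inverse lc)
    where lc = nonSimpleLC-isLC v A
  step-weight (simple v A)    sym-A =
    lc-weight (lc-symmetric sym-A lc) (lc-inverse lc) ∘ diagonal-weight (simpleLC-isDiagonal v A)
    where lc = nonSimpleLC-isLC v A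

  degree-weight : ∀ {A : Mat n} → Symmetric A → ∀ v → HasWeight≤ (suc (degree A v)) A
  degree-weight {A} sym-A v = (_== v) , (v , ==-refl v) , ≤-trans
    (≤-reflexive (F.∥∥-remove {supp A (_== v)} {v} (cong (_∨ img A (_== v) v) (==-refl v))))
    (s≤s (F.∥∥-mono nbr))
    where
    img≡ : ∀ x → img A (_== v) x ≡ A x v
    img≡ x = trans (F.⨁-single v λ y y≢v → trans (cong (A x y ∧_) (==-≢ y≢v)) (∧-zeroʳ (A x y)))
      (trans (cong (A x v ∧_) (==-refl v)) (∧-identityʳ (A x v)))
    nbr : (supp A (_== v) F.∖ v) ⊑ isNbr A v
    nbr x sx with x ≟ v
    ... | no _ = trans (sym-A v x) (trans (sym (img≡ x)) sx)

  local-degree-weight : ∀ {A B} → Symmetric A → LocallyEquivalent A B → ∀ v → HasWeight≤ (suc (degree B v)) A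
  local-degree-weight sym-A ε          v = degree-weight sym-A v
  local-degree-weight sym-A (st ◅ sts) v =
    step-weight st sym-A (local-degree-weight (step-symmetric st sym-A) sts v)

  -- Descent from a vector to a vertex of small degree.

  LowDegree : ℕ → Mat n → Set
  LowDegree k A = ∃ λ B → LocallyEquivalent A B × ∃ λ v → suc (degree B v) ≤ k

  step-lowDegree : ∀ {A B k} → LCStep A B → LowDegree k B → LowDegree k A
  step-lowDegree st (C , eq , v , d) = C , st ◅ eq , v , d

  lowDegree-mono : ∀ {A j k} → j ≤ k → LowDegree j A → LowDegree k A
  lowDegree-mono j≤k (C , eq , v , d) = C , eq , v , ≤-trans d j≤k

  -- The number of nonzero entries is the measure that makes the descent terminate.
  flip-shrinks : ∀ A {v q} → q v ≡ true → nbrSum A v q ≡ true → count (flip A v q) < count q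
  flip-shrinks A {v} {q} qv odd = F.∥∥-strict v flip⊑q flip-v qv
    where
    flip-v : flip A v q v ≡ false
    flip-v = cong₂ _xor_ qv (cong₂ _∧_ (==-refl v) odd)
    flip⊑q : flip A v q ⊑ q
    flip⊑q x q′x with x ≟ v
    ... | yes refl = qv
    ... | no _     = trans (sym (xor-identityʳ (q x))) q′x

  -- Row `v` gains the neighbourhood of `w`, except at `v` itself, where a loop does not count. The
  -- parity of `w` therefore enters without the contribution of `v`, which is 1; this is the source
  -- of the `not`.
  nbrSum-lc : ∀ {A A′ v w q} → IsLocalComplement w A A′ → isNbr A w v ≡ true → q v ≡ true →
    nbrSum A′ v q ≡ not (nbrSum A v q xor nbrSum A w q)
  nbrSum-lc {A} {A′} {v} {w} {q} lc Nwv qv = begin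
    nbrSum A′ v q
      ≡⟨ F.⨁-cong (λ y → cong (λ b → (not (y == v) ∧ b) ∧ q y)
           (trans (lc v y) (cong (λ b → A v y xor (b ∧ isNbr A w y)) Nwv))) ⟩
    xorFin n (λ y → (not (y == v) ∧ (A v y xor isNbr A w y)) ∧ q y)
      ≡⟨ F.⨁-cong (λ y → distribute (not (y == v)) (A v y) (isNbr A w y) (q y)) ⟩
    xorFin n (λ y → (isNbr A v y ∧ q y) xor (not (y == v) ∧ (isNbr A w y ∧ q y)))
      ≡⟨ F.⨁-xor (λ y → isNbr A v y ∧ q y) (λ y → not (y == v) ∧ (isNbr A w y ∧ q y)) ⟩
    nbrSum A v q xor rest
      ≡⟨ double-not (nbrSum A v q) rest ⟩
    not (nbrSum A v q xor (rest xor true))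
      ≡⟨ cong (λ b → not (nbrSum A v q xor (rest xor b))) (sym (∧-true Nwv qv)) ⟩
    not (nbrSum A v q xor (rest xor (isNbr A w v ∧ q v)))
      ≡⟨ cong (λ b → not (nbrSum A v q xor b)) (sym (F.⨁-remove (λ y → isNbr A w y ∧ q y) v)) ⟩
    not (nbrSum A v q xor nbrSum A w q) ∎
    where
    open ≡-Reasoning
    rest : Bool
    rest = xorFin n (λ y → not (y == v) ∧ (isNbr A w y ∧ q y))
    distribute : ∀ a b c d → (a ∧ (b xor c)) ∧ d ≡ ((a ∧ b) ∧ d) xor (a ∧ (c ∧ d))
    distribute = solve 4 (λ a b c d → (a :* (b :+ c)) :* d := ((a :* b) :* d) :+ (a :* (c :* d))) refl
      where open xor-∧-Solver
    double-not : ∀ a b → a xor b ≡ not (a xor (b xor true))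
    double-not true  true  = refl
    double-not true  false = refl
    double-not false true  = refl
    double-not false false = refl

  -- If some neighbour w of v lies off the support, complementing at w keeps q and flips the parity of
  -- q on the neighbours of v; once that parity is odd, complementing at v removes v from q.
  mutual
    weight-lowDegree : ∀ k {A} → Symmetric A → ∀ q → Inhabited q → count q ≤ k → LowDegree (count (supp A q)) A
    weight-lowDegree zero    _ q q≢0 q≤k = contradiction (<-≤-trans (F.∥∥-positive q≢0) q≤k) n≮0
    weight-lowDegree (suc k) {A} sym-A q (v , qv) q≤k with F.inhabited? (λ w → isNbr A v w ∧ not (supp A q w))
    -- Here `v` and all its neighbours lie in the support, so the current graph already serves; the
    -- `suc` accounts for `v`.
    ... | no ∄w = A , ε , v ,
      subst (suc (degree A v) ≤_) (sym (F.∥∥-remove {supp A q} {v} (cong (_∨ img A q v) qv)))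
        (s≤s (F.∥∥-mono (F.⊑-∖ v (λ w Nw → ¬-not λ sw → ∄w (w , ∧-true Nw (cong not sw))) (isNbr-self A v))))
    ... | yes (w , bad) with nbrSum A v q in parity
    ...   | true  = lowDegree-odd k sym-A qv parity q≤k
    ...   | false = step-lowDegree (nonSimple w A) (lowDegree-mono (F.∥∥-mono (lc-supp {q = q} sym-A lc keeps))
      (lowDegree-odd k (step-symmetric (nonSimple w A) sym-A) qv odd q≤k))
      where
      lc : IsLocalComplement w A (nonSimpleLC w A)
      lc = nonSimpleLC-isLC w A
      even-w : nbrSum A w q ≡ false
      even-w = nbrSum-off A q w (not-true (∧-trueʳ {isNbr A v w} bad))
      keeps : IsFlip A w q q
      keeps x = sym (trans (cong (λ b → q x xor ((x == w) ∧ b)) even-w)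
        (trans (cong (q x xor_) (∧-zeroʳ (x == w))) (xor-identityʳ (q x))))
      odd : nbrSum (nonSimpleLC w A) v q ≡ true
      odd = trans (nbrSum-lc {A} {q = q} lc (trans (isNbr-sym {A} sym-A w v) (∧-trueˡ bad)) qv)
        (cong not (cong₂ _xor_ parity even-w))

    lowDegree-odd : ∀ k {A v q} → Symmetric A → q v ≡ true → nbrSum A v q ≡ true → count q ≤ suc k →
      LowDegree (count (supp A q)) A
    lowDegree-odd k {A} {v} {q} sym-A qv odd q≤k = step-lowDegree (nonSimple v A)
      (lowDegree-mono (F.∥∥-mono (lc-supp {q = q} sym-A (nonSimpleLC-isLC v A) λ _ → refl))
        (weight-lowDegree k (step-symmetric (nonSimple v A) sym-A) (flip A v q) (flip-inhabited {A} {v} {q} (v , qv))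
          (s≤s⁻¹ (≤-trans (flip-shrinks A {v} {q} qv odd) q≤k))))

-- Extremal search, counting, transversals, and decidability over element sets.

least : {P : ℕ → Set} → (∀ j → Dec (P j)) → ∀ k → P k → ∃ λ m → m ≤ k × P m × (∀ j → P j → m ≤ j)
least {P} P? k Pk = go k k ≤-refl Pk
  where
  go : ∀ b m → m ≤ b → P m → ∃ λ l → l ≤ m × P l × (∀ j → P j → l ≤ j)
  go b m m≤b Pm with anyUpTo? P? m
  go b m m≤b Pm | no none = m , ≤-refl , Pm , λ j Pj → ≮⇒≥ λ j<m → none (j , j<m , Pj)
  go zero m m≤b Pm | yes (j , j<m , Pj) = contradiction (<-≤-trans j<m m≤b) n≮0
  go (suc b) m m≤b Pm | yes (j , j<m , Pj) with go b j (s≤s⁻¹ (≤-trans j<m m≤b)) Pj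
  ... | l , l≤j , Pl , min = l , ≤-trans l≤j (<⇒≤ j<m) , Pl , min

greatest : {P : ℕ → Set} → (∀ j → Dec (P j)) → P 0 → ∀ b → (∀ j → P j → j ≤ b) →
  ∃ λ m → P m × (∀ j → P j → j ≤ m)
greatest P? P0 zero    bound = 0 , P0 , bound
greatest P? P0 (suc b) bound with P? (suc b)
... | yes Pb = suc b , Pb , bound
... | no ¬Pb = greatest P? P0 b λ j Pj → s≤s⁻¹ (≤∧≢⇒< (bound j Pj) λ { refl → ¬Pb Pj })

count-not : ∀ {n} (p : Fin n → Bool) → count p + count (not ∘ p) ≡ n
count-not {n} p = begin
  count p + count (not ∘ p)                          ≡⟨ sym (sumFin-+ n (⟦_⟧ ∘ p) (⟦_⟧ ∘ not ∘ p)) ⟩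
  sumFin n (λ i → ⟦ p i ⟧ + ⟦ not (p i) ⟧)           ≡⟨ sumFin-cong n (λ i → one (p i)) ⟩
  sumFin n (λ _ → 1)                                 ≡⟨ sumFin-const n 1 ⟩
  n * 1                                              ≡⟨ *-identityʳ n ⟩
  n                                                  ∎
  where
  open ≡-Reasoning
  one : ∀ b → ⟦ b ⟧ + ⟦ not b ⟧ ≡ 1
  one true  = refl
  one false = refl

count-disjoint : ∀ {n} {p q : Fin n → Bool} → (∀ v → p v ≡ true → q v ≡ false) → count p + count q ≤ n
count-disjoint {n} {p} {q} disj = ≤-trans
  (+-monoʳ-≤ (count p) (Summation.∥∥-mono (finSummation n) λ v qv →
    cong not (≢true⇒≡false λ pv → true≢false qv (disj v pv))))
  (≤-reflexive (count-not p))

half : ∀ {a b m} → a ≤ b → a + b ≤ m → 2 * a ≤ m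
half {a} a≤b a+b≤m = ≤-trans (+-monoʳ-≤ a (≤-trans (≤-reflexive (+-identityʳ a)) a≤b)) a+b≤m

count-true : ∀ n → count {n} (λ _ → true) ≡ n
count-true n = trans (sumFin-const n 1) (*-identityʳ n)

transversal-unique : ∀ {n} {T : ESet n} → IsTransversal T → ∀ s t {v} → T (s , v) ≡ true → T (t , v) ≡ true → s ≡ t
transversal-unique {T = T} tr s t {v} Ts Tt =
  unique s t (T (φ , v)) (T (χ , v)) (T (ψ , v)) (tr v) (trans (component s) Ts) (trans (component t) Tt)
  where
  -- Detaching the three Booleans from `T` lets the impossible cases be refuted by evaluating their
  -- sum.
  pick : Tag → Bool → Bool → Bool → Bool
  pick φ a b c = a
  pick χ a b c = b
  pick ψ a b c = c
  component : ∀ s → pick s (T (φ , v)) (T (χ , v)) (T (ψ , v)) ≡ T (s , v)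
  component φ = refl
  component χ = refl
  component ψ = refl
  unique : ∀ s t a b c → ⟦ a ⟧ + ⟦ b ⟧ + ⟦ c ⟧ ≡ 1 → pick s a b c ≡ true → pick t a b c ≡ true → s ≡ t
  unique φ φ _ _ _ _ _ _ = refl
  unique χ χ _ _ _ _ _ _ = refl
  unique ψ ψ _ _ _ _ _ _ = refl
  unique φ χ true true  c    () _ _
  unique χ φ true true  c    () _ _
  unique φ ψ true true  true () _ _
  unique φ ψ true false true () _ _
  unique ψ φ true true  true () _ _
  unique ψ φ true false true () _ _
  unique χ ψ true  true true () _ _
  unique χ ψ false true true () _ _
  unique ψ χ true  true true () _ _
  unique ψ χ false true true () _ _

-- Each triple over `X` contributes at most the one element of `T`, and the other triples contribute
-- nothing.
transverse-card : ∀ {n} {C T : ESet n} {X} → IsTransversal T → C ⊆ T → C ⊆ tau X → card C ≤ count X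
transverse-card {n} {C} {T} {X} tr C⊆T C⊆X = sumFin-mono n at
  where
  off : ∀ t {v} → X v ≡ false → C (t , v) ≡ false
  off t Xv = ≢true⇒≡false λ Ct → true≢false (C⊆X _ Ct) Xv
  at : ∀ v → ⟦ C (φ , v) ⟧ + ⟦ C (χ , v) ⟧ + ⟦ C (ψ , v) ⟧ ≤ ⟦ X v ⟧
  at v with X v in Xv
  ... | true  = ≤-trans (+-mono-≤ (+-mono-≤ (⟦⟧-mono (C⊆T (φ , v))) (⟦⟧-mono (C⊆T (χ , v)))) (⟦⟧-mono (C⊆T (ψ , v))))
    (≤-reflexive (tr v))
  ... | false rewrite off φ Xv | off χ Xv | off ψ Xv = z≤n

occupied : ∀ {n} → ESet n → Fin n → Bool
occupied C v = C (φ , v) ∨ (C (χ , v) ∨ C (ψ , v))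

count-occupied : ∀ {n} (C : ESet n) → count (occupied C) ≤ card C
count-occupied {n} C = sumFin-mono n λ v → at (C (φ , v)) (C (χ , v)) (C (ψ , v))
  where
  at : ∀ a b c → ⟦ a ∨ (b ∨ c) ⟧ ≤ ⟦ a ⟧ + ⟦ b ⟧ + ⟦ c ⟧
  at true  b     c     = s≤s z≤n
  at false true  c     = s≤s z≤n
  at false false true  = s≤s z≤n
  at false false false = z≤n

-- The search runs over three bit vectors, one per tag. Decoding recovers a set only pointwise,
-- hence the demand that `P` respect `SameSet`.
anyESet? : ∀ {n} {P : ESet n → Set} → (∀ {U V} → SameSet U V → P U → P V) → (∀ U → Dec (P U)) → Dec (Σ (ESet n) P)
anyESet? {n} {P} resp P? = map′
  (λ (a , b , c , p) → join a b c , p)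
  (λ (U , p) → restrict U φ , restrict U χ , restrict U ψ , resp (rejoin U) p)
  (anySubset? λ a → anySubset? λ b → anySubset? λ c → P? (join a b c))
  where
  join : Subset n → Subset n → Subset n → ESet n
  join a b c (φ , v) = lookup a v
  join a b c (χ , v) = lookup b v
  join a b c (ψ , v) = lookup c v
  restrict : ESet n → Tag → Subset n
  restrict U t = tabulate (λ v → U (t , v))
  rejoin : ∀ U → SameSet U (join (restrict U φ) (restrict U χ) (restrict U ψ))
  rejoin U (φ , v) = sym (lookup∘tabulate _ v)
  rejoin U (χ , v) = sym (lookup∘tabulate _ v)
  rejoin U (ψ , v) = sym (lookup∘tabulate _ v)

-- Kernel vectors, transverse circuits, and disjoint supports.

module _ {n : ℕ} where
  private
    module F = Summation (finSummation n)
    module E = Summation (elemSummation n)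

  ZeroSum : Mat n → ESet n → Set
  ZeroSum A U = ∀ i → colSum A U i ≡ false

  -- The two coordinates of the sum of the elements of `U` at `v`, with φ, χ, ψ read as (1,0),
  -- (0,1), (1,1).
  φ-coord χ-coord : ESet n → Fin n → Bool
  φ-coord U v = U (φ , v) xor U (ψ , v)
  χ-coord U v = U (χ , v) xor U (ψ , v)

  -- Each ψ column is the sum of the φ and χ columns. Consequently `U` sums to zero exactly when
  -- `φ-coord U` is the image of `χ-coord U`.
  colSum-coord : ∀ A U i → colSum A U i ≡ φ-coord U i xor img A (χ-coord U) i
  colSum-coord A U i = begin
    colSum A U i
      ≡⟨ F.⨁-cong (λ v → regroup (U (φ , v)) (U (χ , v)) (U (ψ , v)) (i == v) (A i v)) ⟩
    xorFin n (λ v → ((i == v) ∧ φ-coord U v) xor (A i v ∧ χ-coord U v))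
      ≡⟨ F.⨁-xor (λ v → (i == v) ∧ φ-coord U v) (λ v → A i v ∧ χ-coord U v) ⟩
    xorFin n (λ v → (i == v) ∧ φ-coord U v) xor img A (χ-coord U) i
      ≡⟨ cong (_xor img A (χ-coord U) i) (F.⨁-single i λ v v≢i → cong (_∧ φ-coord U v) (==-≢ (v≢i ∘ sym))) ⟩
    ((i == i) ∧ φ-coord U i) xor img A (χ-coord U) i
      ≡⟨ cong (λ b → (b ∧ φ-coord U i) xor img A (χ-coord U) i) (==-refl i) ⟩
    φ-coord U i xor img A (χ-coord U) i ∎
    where
    open ≡-Reasoning
    regroup : ∀ a b c e m → (a ∧ e) xor ((b ∧ m) xor (c ∧ (m xor e))) ≡ (e ∧ (a xor c)) xor (m ∧ (b xor c))
    regroup = solve 5 (λ a b c e m → (a :* e) :+ ((b :* m) :+ (c :* (m :+ e))) := (e :* (a :+ c)) :+ (m :* (b :+ c))) refl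
      where open xor-∧-Solver

  img-cong : ∀ A {q q′ : Fin n → Bool} → (∀ v → q v ≡ q′ v) → ∀ x → img A q x ≡ img A q′ x
  img-cong A q≗q′ x = F.⨁-cong λ y → cong (A x y ∧_) (q≗q′ y)

  -- At `v` this selects the one element with coordinates `(img A q v , q v)`, or none if both are
  -- 0.
  vectorSet : Mat n → (Fin n → Bool) → ESet n
  vectorSet A q (φ , v) = not (q v) ∧ img A q v
  vectorSet A q (χ , v) = q v ∧ not (img A q v)
  vectorSet A q (ψ , v) = q v ∧ img A q v

  vectorSet-zeroSum : ∀ A q → ZeroSum A (vectorSet A q)
  vectorSet-zeroSum A q i = begin
    colSum A (vectorSet A q) i
      ≡⟨ colSum-coord A (vectorSet A q) i ⟩
    φ-coord (vectorSet A q) i xor img A (χ-coord (vectorSet A q)) i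
      ≡⟨ cong₂ _xor_ (φ≡ (q i) (img A q i)) (img-cong A (λ v → χ≡ (q v) (img A q v)) i) ⟩
    img A q i xor img A q i
      ≡⟨ xor-same (img A q i) ⟩
    false ∎
    where
    open ≡-Reasoning
    φ≡ : ∀ a b → (not a ∧ b) xor (a ∧ b) ≡ b
    φ≡ true  b = refl
    φ≡ false b = xor-identityʳ b
    χ≡ : ∀ a b → (a ∧ not b) xor (a ∧ b) ≡ a
    χ≡ true  true  = refl
    χ≡ true  false = refl
    χ≡ false b     = refl

  vectorSet-inhabited : ∀ A {q} → Inhabited q → Inhabited (vectorSet A q)
  vectorSet-inhabited A {q} (v , qv) with img A q v in iv
  ... | true  = (ψ , v) , ∧-true qv iv
  ... | false = (χ , v) , ∧-true qv (cong not iv)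

  vectorSet-support : ∀ A q → vectorSet A q ⊆ tau (supp A q)
  vectorSet-support A q (φ , v) p rewrite ∧-trueʳ {not (q v)} p = ∨-zeroʳ (q v)
  vectorSet-support A q (χ , v) p rewrite ∧-trueˡ {q v} p = refl
  vectorSet-support A q (ψ , v) p rewrite ∧-trueˡ {q v} p = refl

  -- Completes `vectorSet` by φ at the vertices off the support.
  vectorTransversal : Mat n → (Fin n → Bool) → ESet n
  vectorTransversal A q (φ , v) = not (q v)
  vectorTransversal A q (χ , v) = q v ∧ not (img A q v)
  vectorTransversal A q (ψ , v) = q v ∧ img A q v

  vectorTransversal-transversal : ∀ A q → IsTransversal (vectorTransversal A q)
  vectorTransversal-transversal A q v with q v | img A q v
  ... | true  | true  = refl
  ... | true  | false = refl
  ... | false | _     = refl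

  vectorSet-transverse : ∀ A q → vectorSet A q ⊆ vectorTransversal A q
  vectorSet-transverse A q (φ , v) p = ∧-trueˡ p
  vectorSet-transverse A q (χ , v) p = p
  vectorSet-transverse A q (ψ , v) p = p

  ⊆? : (U V : ESet n) → Dec (U ⊆ V)
  ⊆? U V = map′
    (λ none w Uw → ¬-not λ Vw → none (w , ∧-true Uw (cong not Vw)))
    (λ U⊆V (w , p) → true≢false (U⊆V w (∧-trueˡ p)) (not-true (∧-trueʳ {U w} p)))
    (¬? (inhabitedElem? (λ w → U w ∧ not (V w))))

  zeroSum? : ∀ A U → Dec (ZeroSum A U)
  zeroSum? A U = all? λ i → colSum A U i Bool.≟ false

  colSum-cong : ∀ A {U V} → SameSet U V → ∀ i → colSum A U i ≡ colSum A V i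
  colSum-cong A U≗V i = E.⨁-cong λ w → cong (_∧ column A w i) (U≗V w)

  Relation : Mat n → ESet n → ESet n → Set
  Relation A S U = U ⊆ S × Inhabited U × ZeroSum A U

  relation-resp : ∀ {A S U V} → SameSet U V → Relation A S U → Relation A S V
  relation-resp {A} U≗V (U⊆S , (w , Uw) , zeroU) =
    (λ w Vw → U⊆S w (trans (U≗V w) Vw)) , (w , trans (sym (U≗V w)) Uw) ,
    λ i → trans (sym (colSum-cong A U≗V i)) (zeroU i)

  relation? : ∀ A S U → Dec (Relation A S U)
  relation? A S U = ⊆? U S ×-dec inhabitedElem? U ×-dec zeroSum? A U

  no-relation⇒independent : ∀ {A S} → ¬ ∃ (Relation A S) → Independent A S
  no-relation⇒independent none U U⊆S zeroU w = ≢true⇒≡false λ Uw → none (U , U⊆S , (w , Uw) , zeroU)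

  independent⇒no-relation : ∀ {A S} → Independent A S → ¬ ∃ (Relation A S)
  independent⇒no-relation ind (U , U⊆S , (w , Uw) , zeroU) = true≢false Uw (ind U U⊆S zeroU w)

  independent? : ∀ A S → Dec (Independent A S)
  independent? A S = map′ no-relation⇒independent independent⇒no-relation
    (¬? (anyESet? relation-resp (relation? A S)))

  -- A circuit is given only as a negated independence; finite search turns this into a witness.
  dependent⇒relation : ∀ {A S} → ¬ Independent A S → ∃ (Relation A S)
  dependent⇒relation {A} {S} dep with anyESet? relation-resp (relation? A S)
  ... | yes rel = rel
  ... | no none = contradiction (no-relation⇒independent none) dep

  smallerRelation? : ∀ A U → Dec (∃ λ V → Relation A U V × card V < card U)
  smallerRelation? A U = anyESet?
    (λ {V} {W} V≗W (rel , lt) → relation-resp V≗W rel ,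
      ≤-<-trans (E.∥∥-mono {W} {V} λ w Ww → trans (V≗W w) Ww) lt)
    (λ V → relation? A U V ×-dec card V <? card U)

  -- A relation inside `V ⊆ U` has at least as many elements as `U`, which forces `V` to be all of
  -- `U`.
  smallest⇒circuit : ∀ {A U} → Inhabited U → ZeroSum A U →
    ¬ (∃ λ V → Relation A U V × card V < card U) → IsCircuit A U
  smallest⇒circuit {A} {U} U≢∅ zeroU none =
    (λ ind → independent⇒no-relation ind (U , (λ _ → id) , U≢∅ , zeroU)) ,
    λ V V⊆U V≄U → no-relation⇒independent λ (W , W⊆V , W≢∅ , zeroW) →
      let W⊆U = λ w Ww → V⊆U w (W⊆V w Ww)
          U≤W = ≮⇒≥ λ W<U → none (W , (W⊆U , W≢∅ , zeroW) , W<U)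
      in V≄U (E.⊑-antisym-∥∥ {V} {U} V⊆U (≤-trans U≤W (E.∥∥-mono {W} {V} W⊆V)))

  circuit-below : ∀ {A} k U → Inhabited U → ZeroSum A U → card U ≤ k → ∃ λ C → C ⊆ U × IsCircuit A C
  circuit-below zero    U U≢∅ zeroU U≤k = contradiction (<-≤-trans (E.∥∥-positive U≢∅) U≤k) n≮0
  circuit-below {A} (suc k) U U≢∅ zeroU U≤k with smallerRelation? A U
  ... | no none = U , (λ _ → id) , smallest⇒circuit U≢∅ zeroU none
  ... | yes (V , (V⊆U , V≢∅ , zeroV) , V<U) with circuit-below k V V≢∅ zeroV (s≤s⁻¹ (≤-trans V<U U≤k))
  ...   | C , C⊆V , circ = C , (λ w Cw → V⊆U w (C⊆V w Cw)) , circ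

  vector⇒circuit : ∀ A q → Inhabited q → ∃ λ C → IsTransverseCircuit A C × C ⊆ tau (supp A q)
  vector⇒circuit A q q≢0 =
    let C , C⊆U , circ = circuit-below (card (vectorSet A q)) (vectorSet A q)
                           (vectorSet-inhabited A {q} q≢0) (vectorSet-zeroSum A q) ≤-refl
    in C ,
       (circ , vectorTransversal A q , vectorTransversal-transversal A q ,
         λ w Cw → vectorSet-transverse A q w (C⊆U w Cw)) ,
       λ w Cw → vectorSet-support A q w (C⊆U w Cw)

  -- The vector is `χ-coord U`, whose image is `φ-coord U` since `U` sums to zero. Transversality
  -- prevents elements of one triple from cancelling, so the vector is nonzero.
  relation⇒vector : ∀ {A C T} → IsTransversal T → C ⊆ T → ∃ (Relation A C) → ∃ λ q → Inhabited q × supp A q ⊑ occupied C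
  relation⇒vector {A} {C} {T} tr C⊆T (U , U⊆C , (w , Uw) , zeroU) = χ-coord U , nonzero w Uw , ⊑-by-false off
    where
    φ≡img : ∀ v → φ-coord U v ≡ img A (χ-coord U) v
    φ≡img v = xor≡false⇒≡ (trans (sym (colSum-coord A U v)) (zeroU v))
    other : ∀ s t {v} → s ≢ t → U (s , v) ≡ true → U (t , v) ≡ false
    other s t s≢t Us = ≢true⇒≡false λ Ut →
      s≢t (transversal-unique {T = T} tr s t (C⊆T _ (U⊆C _ Us)) (C⊆T _ (U⊆C _ Ut)))
    nonzero : ∀ w → U w ≡ true → Inhabited (χ-coord U)
    nonzero (χ , v) Uw = v , cong₂ _xor_ Uw (other χ ψ (λ ()) Uw)
    nonzero (ψ , v) Uw = v , cong₂ _xor_ (other ψ χ (λ ()) Uw) Uw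
    -- A φ element does not show in `χ-coord`, but it makes the image nonzero at `v`, so the vector
    -- has a nonzero entry somewhere.
    nonzero (φ , v) Uw =
      let y , Aq = F.⨁-inhabited {λ y → A v y ∧ χ-coord U y}
                     (trans (sym (φ≡img v)) (cong₂ _xor_ Uw (other φ ψ (λ ()) Uw)))
      in y , ∧-trueʳ {A v y} Aq
    off : ∀ v → occupied C v ≡ false → supp A (χ-coord U) v ≡ false
    off v Cv = cong₂ _∨_ (cong₂ _xor_ (U≡0 χ Cχ) (U≡0 ψ Cψ))
      (trans (sym (φ≡img v)) (cong₂ _xor_ (U≡0 φ Cφ) (U≡0 ψ Cψ)))
      where
      Cφ = proj₁ (∨-false {C (φ , v)} Cv)
      Cχ = proj₁ (∨-false {C (χ , v)} (proj₂ (∨-false {C (φ , v)} Cv)))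
      Cψ = proj₂ (∨-false {C (χ , v)} (proj₂ (∨-false {C (φ , v)} Cv)))
      U≡0 : ∀ t → C (t , v) ≡ false → U (t , v) ≡ false
      U≡0 t Ct = ≢true⇒≡false λ Ut → true≢false (U⊆C _ Ut) Ct

  circuit⇒vector : ∀ {A : Mat n} {C} → IsTransverseCircuit A C → ∃ λ q → Inhabited q × supp A q ⊑ occupied C
  circuit⇒vector ((dep , _) , T , tr , C⊆T) = relation⇒vector tr C⊆T (dependent⇒relation dep)

  -- The common intermediate form of the light vector, circuit pair and connectivity conditions.
  DisjointVectors : Mat n → Set
  DisjointVectors A = ∃ λ q → ∃ λ q′ → Inhabited q × Inhabited q′ × (∀ v → supp A q v ≡ true → supp A q′ v ≡ false)

  img-adjoint : ∀ {A : Mat n} → Symmetric A → ∀ q y → xorFin n (λ x → q x ∧ img A y x) ≡ xorFin n (λ x → img A q x ∧ y x)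
  img-adjoint {A} sym-A q y = begin
    xorFin n (λ x → q x ∧ img A y x)
      ≡⟨ F.⨁-cong (λ x → sym (F.⨁-scale (q x) _)) ⟩
    xorFin n (λ x → xorFin n (λ z → q x ∧ (A x z ∧ y z)))
      ≡⟨ ⨁-xorFin (finSummation n) n _ ⟩
    xorFin n (λ z → xorFin n (λ x → q x ∧ (A x z ∧ y z)))
      ≡⟨ F.⨁-cong (λ z → F.⨁-cong λ x → trans (rotate (q x) (A x z) (y z)) (cong (λ b → y z ∧ (b ∧ q x)) (sym-A x z))) ⟩
    xorFin n (λ z → xorFin n (λ x → y z ∧ (A z x ∧ q x)))
      ≡⟨ F.⨁-cong (λ z → trans (F.⨁-scale (y z) _) (∧-comm (y z) _)) ⟩
    xorFin n (λ z → img A q z ∧ y z) ∎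
    where
    open ≡-Reasoning
    rotate : ∀ a b c → a ∧ (b ∧ c) ≡ c ∧ (b ∧ a)
    rotate = solve 3 (λ a b c → a :* (b :* c) := c :* (b :* a)) refl
      where open xor-∧-Solver

  -- The equations (A y) u = 0 for u in the support of q are dependent on vectors y vanishing there,
  -- since q · A y = A q · y = 0; dropping one leaves fewer equations than unknowns.
  lightVector⇒disjoint : ∀ {A : Mat n} → Symmetric A → ∀ q → Inhabited q → 2 * count (supp A q) ≤ n → DisjointVectors A
  lightVector⇒disjoint {A} sym-A q (v , qv) 2X≤n
    with homogeneous-solution (finSummation n) (finSummation n) (supp A q F.∖ v) (not ∘ supp A q) A fewer
    where
    X : ℕ
    X = count (supp A q)
    fewer : count (supp A q F.∖ v) < count (not ∘ supp A q)
    fewer = begin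
      suc (count (supp A q F.∖ v))    ≡⟨ sym (F.∥∥-remove {supp A q} (cong (_∨ img A q v) qv)) ⟩
      X                               ≤⟨ +-cancelˡ-≤ X X (count (not ∘ supp A q)) (begin
        X + X                             ≡⟨ cong (X +_) (sym (+-identityʳ X)) ⟩
        2 * X                             ≤⟨ 2X≤n ⟩
        n                                 ≡⟨ sym (count-not (supp A q)) ⟩
        X + count (not ∘ supp A q)        ∎) ⟩
      count (not ∘ supp A q)          ∎
      where open ≤-Reasoning
  ... | y , y⊑ , y≢0 , sol = q , y , (v , qv) , y≢0 , λ x sx → cong₂ _∨_ (y-off x sx) (img-off x sx)
    where
    y-off : ∀ x → supp A q x ≡ true → y x ≡ false
    y-off x sx = ≢true⇒≡false λ yx → true≢false sx (not-true (y⊑ x yx))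
    q⊑ : q ⊑ supp A q
    q⊑ x qx = cong (_∨ img A q x) qx
    img⊑ : img A q ⊑ supp A q
    img⊑ x ix = trans (cong (q x ∨_) ix) (∨-zeroʳ (q x))
    img-off-v : img A y v ≡ false
    img-off-v = begin
      img A y v                            ≡⟨ sym (cong (_∧ img A y v) qv) ⟩
      q v ∧ img A y v                      ≡⟨ sym (F.⨁-single v λ x x≢v → ≢true⇒≡false λ p →
                                                true≢false (∧-trueʳ {q x} p)
                                                  (sol x (trans (F.∖-other (supp A q) x≢v) (q⊑ x (∧-trueˡ p))))) ⟩
      xorFin n (λ x → q x ∧ img A y x)     ≡⟨ img-adjoint sym-A q y ⟩
      xorFin n (λ x → img A q x ∧ y x)     ≡⟨ F.⨁-vanish (λ x → ≢true⇒≡false λ p →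
                                                true≢false (∧-trueʳ {img A q x} p) (y-off x (img⊑ x (∧-trueˡ p)))) ⟩
      false                                ∎
      where open ≡-Reasoning
    img-off : ∀ x → supp A q x ≡ true → img A y x ≡ false
    img-off x sx with x ≟ v
    ... | yes refl = img-off-v
    ... | no x≢v = sol x (trans (F.∖-other (supp A q) x≢v) sx)

  -- The smaller of two disjoint supports covers at most half of the vertices.
  disjoint⇒lightVector : ∀ {A : Mat n} → DisjointVectors A → ∃ λ q → Inhabited q × 2 * count (supp A q) ≤ n
  disjoint⇒lightVector {A} (q , q′ , q≢0 , q′≢0 , disj) with ≤-total (count (supp A q)) (count (supp A q′))
  ... | inj₁ q≤q′ = q , q≢0 , half q≤q′ (count-disjoint disj)
  ... | inj₂ q′≤q = q′ , q′≢0 , half q′≤q (≤-trans (≤-reflexive (+-comm (count (supp A q′)) _)) (count-disjoint disj))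

-- Functionals on the columns, and matroid rank.

module _ {n : ℕ} where
  private
    module F = Summation (finSummation n)
    module E = Summation (elemSummation n)

  pairing : Mat n → (Fin n → Bool) → Elem n → Bool
  pairing A q w = xorFin n (λ i → column A w i ∧ q i)

  pairing-φ : ∀ A q v → pairing A q (φ , v) ≡ q v
  pairing-φ A q v = trans (F.⨁-single v λ i i≢v → cong (_∧ q i) (==-≢ i≢v)) (cong (_∧ q v) (==-refl v))

  pairing-χ : ∀ {A : Mat n} → Symmetric A → ∀ q v → pairing A q (χ , v) ≡ img A q v
  pairing-χ sym-A q v = F.⨁-cong λ i → cong (_∧ q i) (sym-A i v)

  pairing-ψ : ∀ {A : Mat n} → Symmetric A → ∀ q v → pairing A q (ψ , v) ≡ img A q v xor q v
  pairing-ψ {A} sym-A q v = trans (F.⨁-cong λ i → ∧-distribʳ-xor (q i) (A i v) (i == v))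
    (trans (F.⨁-xor (λ i → A i v ∧ q i) (λ i → (i == v) ∧ q i))
      (cong₂ _xor_ (pairing-χ {A} sym-A q v) (pairing-φ A q v)))

  pairing-colSum : ∀ (A : Mat n) q U → xorFin n (λ i → colSum A U i ∧ q i) ≡ xorElem (λ w → U w ∧ pairing A q w)
  pairing-colSum A q U = begin
    xorFin n (λ i → colSum A U i ∧ q i)
      ≡⟨ F.⨁-cong (λ i → trans (∧-comm (colSum A U i) (q i)) (sym (E.⨁-scale (q i) (λ w → U w ∧ column A w i)))) ⟩
    xorFin n (λ i → xorElem (λ w → q i ∧ (U w ∧ column A w i)))
      ≡⟨ sym (⨁-xorFin (elemSummation n) n (λ w i → q i ∧ (U w ∧ column A w i))) ⟩
    xorElem (λ w → xorFin n (λ i → q i ∧ (U w ∧ column A w i)))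
      ≡⟨ E.⨁-cong (λ w → F.⨁-cong (λ i → rotate (q i) (U w) (column A w i))) ⟩
    xorElem (λ w → xorFin n (λ i → U w ∧ (column A w i ∧ q i)))
      ≡⟨ E.⨁-cong (λ w → F.⨁-scale (U w) (λ i → column A w i ∧ q i)) ⟩
    xorElem (λ w → U w ∧ pairing A q w) ∎
    where
    open ≡-Reasoning
    rotate : ∀ a b c → a ∧ (b ∧ c) ≡ b ∧ (c ∧ a)
    rotate = solve 3 (λ a b c → a :* (b :* c) := b :* (c :* a)) refl
      where open xor-∧-Solver

  Annihilates : Mat n → (Fin n → Bool) → ESet n → Set
  Annihilates A q S = ∀ w → S w ≡ true → pairing A q w ≡ false

  -- The elements of `T` are the unknowns and the coordinates in `s` the equations. Restricting to
  -- `s` allows a redundant coordinate to be left out.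
  relation-of-many : ∀ A T (s : Fin n → Bool) → count s < card T →
    ∃ λ U → U ⊆ T × Inhabited U × (∀ i → s i ≡ true → colSum A U i ≡ false)
  relation-of-many A T s s<T =
    let U , U⊆T , U≢∅ , sol = homogeneous-solution (elemSummation n) (finSummation n) s T (λ i w → column A w i) s<T
    in U , U⊆T , U≢∅ , λ i si → trans (E.⨁-cong λ w → ∧-comm (U w) (column A w i)) (sol i si)

  independent-card≤ : ∀ {A : Mat n} {T} → Independent A T → card T ≤ n
  independent-card≤ {A} {T} ind = ≮⇒≥ λ n<T →
    let U , U⊆T , U≢∅ , sol = relation-of-many A T (λ _ → true) (≤-<-trans (≤-reflexive (count-true n)) n<T)
    in independent⇒no-relation ind (U , U⊆T , U≢∅ , λ i → sol i refl)

  -- Every sum of columns from `S` is killed by `q`, so its coordinate at `i₀`, where `q` is 1, is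
  -- determined by the others. That leaves `n - 1` equations, and `n` elements would already be
  -- dependent.
  annihilated-card< : ∀ {A : Mat n} {q S T} → Inhabited q → Annihilates A q S → T ⊆ S → Independent A T → card T < n
  annihilated-card< {A} {q} {S} {T} (i₀ , qi₀) ann T⊆S ind = ≰⇒> λ n≤T →
    let U , U⊆T , U≢∅ , sol = relation-of-many A T ((λ _ → true) F.∖ i₀) (≤-trans fewer n≤T)
    in independent⇒no-relation ind (U , U⊆T , U≢∅ , λ i → zeroSum U U⊆T sol i)
    where
    fewer : count {n} ((λ _ → true) F.∖ i₀) < n
    fewer = ≤-reflexive (trans (sym (F.∥∥-remove {λ _ → true} {i₀} refl)) (count-true n))
    zeroSum : ∀ U → U ⊆ T → (∀ i → ((λ _ → true) F.∖ i₀) i ≡ true → colSum A U i ≡ false) → ZeroSum A U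
    zeroSum U U⊆T sol i with i ≟ i₀
    ... | no i≢i₀ = sol i (F.∖-other (λ _ → true) i≢i₀)
    ... | yes refl = begin
      colSum A U i                              ≡⟨ sym (∧-identityʳ (colSum A U i)) ⟩
      colSum A U i ∧ true                       ≡⟨ cong (colSum A U i ∧_) (sym qi₀) ⟩
      colSum A U i ∧ q i                        ≡⟨ sym (F.⨁-single i {λ j → colSum A U j ∧ q j} λ j j≢i →
                                                     cong (_∧ q j) (sol j (F.∖-other (λ _ → true) j≢i))) ⟩
      xorFin n (λ j → colSum A U j ∧ q j)       ≡⟨ pairing-colSum A q U ⟩
      xorElem (λ w → U w ∧ pairing A q w)       ≡⟨ E.⨁-vanish (λ w → ≢true⇒≡false λ p →
                                                     true≢false (∧-trueʳ {U w} p) (ann w (T⊆S w (U⊆T w (∧-trueˡ p))))) ⟩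
      false                                     ∎
      where open ≡-Reasoning

  insert : ESet n → Elem n → ESet n
  insert T w u = T u ∨ does (u ≟ᵉ w)

  insert-self : ∀ T w → insert T w w ≡ true
  insert-self T w = trans (cong (T w ∨_) (dec-true (w ≟ᵉ w) refl)) (∨-zeroʳ (T w))

  insert-other : ∀ T {u w} → u ≢ w → insert T w u ≡ T u
  insert-other T {u} {w} u≢w = trans (cong (T u ∨_) (dec-false (u ≟ᵉ w) u≢w)) (∨-identityʳ (T u))

  -- A functional vanishing on a maximal independent subset T of S vanishes on each w in S,
  -- because adding w to T creates a relation in which w occurs.
  rank<⇒annihilator : ∀ {A : Mat n} {S k} → IsRank A S k → k < n → ∃ λ q → Inhabited q × Annihilates A q S
  rank<⇒annihilator {A} {S} {k} ((T , T⊆S , ind , T≡k) , maximal) k<n =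
    let q , _ , q≢0 , sol = homogeneous-solution (finSummation n) (elemSummation n) T (λ _ → true) (column A)
                              (subst₂ _<_ (sym T≡k) (sym (count-true n)) k<n)
    in q , q≢0 , extend q sol
    where
    module _ (q : Fin n → Bool) (sol : Annihilates A q T) where
      occurs : ∀ {w} → ∃ (Relation A (insert T w)) → pairing A q w ≡ false
      occurs {w} (U , U⊆ , U≢∅ , zeroU) = begin
        pairing A q w                            ≡⟨ cong (_∧ pairing A q w) (sym Uw) ⟩
        U w ∧ pairing A q w                      ≡⟨ sym (E.⨁-single w {λ u → U u ∧ pairing A q u} λ u u≢w →
                                                      ≢true⇒≡false λ p → true≢false (∧-trueʳ {U u} p)
                                                        (sol u (inT u≢w (∧-trueˡ p)))) ⟩
        xorElem (λ u → U u ∧ pairing A q u)      ≡⟨ sym (pairing-colSum A q U) ⟩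
        xorFin n (λ i → colSum A U i ∧ q i)      ≡⟨ F.⨁-vanish (λ i → cong (_∧ q i) (zeroU i)) ⟩
        false                                    ∎
        where
        open ≡-Reasoning
        inT : ∀ {u} → u ≢ w → U u ≡ true → T u ≡ true
        inT {u} u≢w Uu = trans (sym (insert-other T u≢w)) (U⊆ u Uu)
        Uw : U w ≡ true
        Uw = ¬-not λ Uw≡0 → independent⇒no-relation ind
          (U , (λ u Uu → inT (λ { refl → true≢false Uu Uw≡0 }) Uu) , U≢∅ , zeroU)
      extend : Annihilates A q S
      extend w Sw with T w in Tw
      ... | true  = sol w Tw
      ... | false = occurs (dependent⇒relation λ ind′ → <⇒≱
        (E.∥∥-strict {T} {insert T w} w (λ u Tu → cong (_∨ does (u ≟ᵉ w)) Tu) Tw (insert-self T w))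
        (≤-trans (maximal (insert T w) insert⊆S ind′) (≤-reflexive (sym T≡k))))
        where
        insert⊆S : insert T w ⊆ S
        insert⊆S u p with u ≟ᵉ w
        ... | yes refl = Sw
        ... | no u≢w   = T⊆S u (trans (sym (insert-other T u≢w)) p)

  -- The sizes of independent subsets form a decidable set containing 0 and bounded by `n`.
  rank-exists : ∀ A S → ∃ (IsRank A S)
  rank-exists A S =
    let k , attained , bound = greatest {λ j → Σ (ESet n) λ T → T ⊆ S × Independent A T × card T ≡ j} size?
          ((λ _ → false) , (λ _ ()) , (λ U U⊆∅ _ w → ≢true⇒≡false λ Uw → contradiction (U⊆∅ w Uw) λ ()) , card-∅)
          n (λ j (T , _ , ind , T≡j) → subst (_≤ n) T≡j (independent-card≤ ind))
    in k , attained , λ T T⊆S ind → bound (card T) (T , T⊆S , ind , refl)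
    where
    card-∅ : card {n} (λ _ → false) ≡ 0
    card-∅ = trans (sumFin-const n 0) (*-zeroʳ n)
    independent-resp : ∀ {T T′} → SameSet T T′ → Independent A T → Independent A T′
    independent-resp T≗T′ ind U U⊆T′ = ind U λ w Uw → trans (T≗T′ w) (U⊆T′ w Uw)
    size? : ∀ j → Dec (Σ (ESet n) λ T → T ⊆ S × Independent A T × card T ≡ j)
    size? j = anyESet?
      (λ {T} {T′} T≗T′ (T⊆S , ind , T≡j) →
        (λ w T′w → T⊆S w (trans (T≗T′ w) T′w)) , independent-resp T≗T′ ind ,
        trans (≤-antisym (E.∥∥-mono {T′} {T} λ w p → trans (T≗T′ w) p) (E.∥∥-mono {T} {T′} λ w p → trans (sym (T≗T′ w)) p)) T≡j)
      (λ T → ⊆? T S ×-dec independent? A T ×-dec card T ≟ⁿ j)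

  rank-unique : ∀ {A : Mat n} {S a b} → IsRank A S a → IsRank A S b → a ≡ b
  rank-unique ((T , T⊆S , ind , T≡a) , max) ((T′ , T′⊆S , ind′ , T′≡b) , max′) =
    ≤-antisym (subst (_≤ _) T≡a (max′ T T⊆S ind)) (subst (_≤ _) T′≡b (max T′ T′⊆S ind′))

  rank-resp : ∀ {A : Mat n} {S S′ k} → SameSet S S′ → IsRank A S k → IsRank A S′ k
  rank-resp S≗S′ ((T , T⊆S , rest) , max) =
    (T , (λ w Tw → trans (sym (S≗S′ w)) (T⊆S w Tw)) , rest) ,
    λ T′ T′⊆S′ → max T′ λ w T′w → trans (S≗S′ w) (T′⊆S′ w T′w)

  rank-full : ∀ A → IsRank A full n
  rank-full A = (basis , (λ _ _ → refl) , independent , trans (sumFin-const n 1) (*-identityʳ n)) ,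
    λ T _ ind → independent-card≤ ind
    where
    basis : ESet n
    basis (φ , _) = true
    basis (χ , _) = false
    basis (ψ , _) = false
    independent : Independent A basis
    independent U U⊆ zeroU = λ
      { (φ , v) → trans (sym (xor-identityʳ (U (φ , v)))) (trans (cong (U (φ , v) xor_) (sym (ψ≡0 v))) (φ-coord≡0 v))
      ; (χ , v) → χ≡0 v
      ; (ψ , v) → ψ≡0 v }
      where
      χ≡0 : ∀ v → U (χ , v) ≡ false
      χ≡0 v = ≢true⇒≡false λ p → contradiction (U⊆ (χ , v) p) λ ()
      ψ≡0 : ∀ v → U (ψ , v) ≡ false
      ψ≡0 v = ≢true⇒≡false λ p → contradiction (U⊆ (ψ , v) p) λ ()
      φ-coord≡0 : ∀ v → φ-coord U v ≡ false
      φ-coord≡0 v = trans (xor≡false⇒≡ (trans (sym (colSum-coord A U v)) (zeroU v)))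
        (F.⨁-vanish λ y → trans (cong (A v y ∧_) (cong₂ _xor_ (χ≡0 y) (ψ≡0 y))) (∧-zeroʳ (A v y)))

  -- Connectivity and vertical separations.

  separation? : ∀ A k S → Dec (VerticalSeparation A k S)
  separation? A k S = map′
    (λ (lt , k≤a , k≤b) → a , b , n , ra , rb , rank-full A , lt , k≤a , k≤b)
    (λ (a′ , b′ , r′ , ra′ , rb′ , rr′ , p) →
      transport (rank-unique ra′ ra) (rank-unique rb′ rb) (rank-unique rr′ (rank-full A)) p)
    (a + b <? k + n ×-dec k ≤? a ×-dec k ≤? b)
    where
    a b : ℕ
    a = proj₁ (rank-exists A S)
    b = proj₁ (rank-exists A (complement S))
    ra : IsRank A S a
    ra = proj₂ (rank-exists A S)
    rb : IsRank A (complement S) b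
    rb = proj₂ (rank-exists A (complement S))
    transport : ∀ {a′ b′ r′} → a′ ≡ a → b′ ≡ b → r′ ≡ n →
      a′ + b′ < k + r′ × k ≤ a′ × k ≤ b′ → a + b < k + n × k ≤ a × k ≤ b
    transport refl refl refl p = p

  separation-resp : ∀ {A : Mat n} {k S S′} → SameSet S S′ → VerticalSeparation A k S → VerticalSeparation A k S′
  separation-resp S≗S′ (a , b , r , ra , rb , rest) =
    a , b , r , rank-resp S≗S′ ra , rank-resp (λ w → cong not (S≗S′ w)) rb , rest

  candidate? : ∀ A k → Dec (KappaCandidate A k)
  candidate? A k = anyESet? separation-resp (separation? A k) ⊎-dec
    map′ (λ { refl → rank-full A }) (rank-unique (rank-full A)) (n ≟ⁿ k)

  off-support⇒annihilates : ∀ {A : Mat n} → Symmetric A → ∀ q {S} →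
    (∀ w → S w ≡ true → supp A q (vertexOf w) ≡ false) → Annihilates A q S
  off-support⇒annihilates {A} sym-A q {S} off (t , v) Sw = at t
    where
    qv : q v ≡ false
    qv = proj₁ (supp-off A q v (off (t , v) Sw))
    iv : img A q v ≡ false
    iv = proj₂ (supp-off A q v (off (t , v) Sw))
    at : ∀ t → pairing A q (t , v) ≡ false
    at φ = trans (pairing-φ A q v) qv
    at χ = trans (pairing-χ {A} sym-A q v) iv
    at ψ = trans (pairing-ψ {A} sym-A q v) (cong₂ _xor_ iv qv)

  -- A nonzero functional vanishes on all of a vertex triple or on exactly one of its elements,
  -- so two of them covering the triple cannot both be nonzero there.
  covering⇒disjoint : ∀ {A : Mat n} → Symmetric A → ∀ {S} q q′ → Annihilates A q S → Annihilates A q′ (complement S) →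
    ∀ v → supp A q v ≡ true → supp A q′ v ≡ false
  covering⇒disjoint {A} sym-A {S} q q′ ann ann′ v = at (q v) (img A q v) (q′ v) (img A q′ v)
    (subst₂ (λ a b → a ∧ b ≡ false) (pairing-φ A q v) (pairing-φ A q′ v) (cover φ))
    (subst₂ (λ a b → a ∧ b ≡ false) (pairing-χ {A} sym-A q v) (pairing-χ {A} sym-A q′ v) (cover χ))
    (subst₂ (λ a b → a ∧ b ≡ false) (pairing-ψ {A} sym-A q v) (pairing-ψ {A} sym-A q′ v) (cover ψ))
    where
    cover : ∀ t → pairing A q (t , v) ∧ pairing A q′ (t , v) ≡ false
    cover t with S (t , v) in Stv
    ... | true  = cong (_∧ pairing A q′ (t , v)) (ann (t , v) Stv)
    ... | false = trans (cong (pairing A q (t , v) ∧_) (ann′ (t , v) (cong not Stv))) (∧-zeroʳ _)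
    at : ∀ a b c d → a ∧ c ≡ false → b ∧ d ≡ false → (b xor a) ∧ (d xor c) ≡ false → a ∨ b ≡ true → c ∨ d ≡ false
    at true  true  false false _ _ _ _ = refl
    at true  false false false _ _ _ _ = refl
    at false true  false false _ _ _ _ = refl
    at true  true  false true  _ () _ _
    at true  false false true  _ _ () _
    at false true  true  false _ _ () _
    at false true  false true  _ () _ _
    at false true  true  true  _ () _ _

  -- Separate the triples off the support of `q` from those on it: `q` annihilates the first side
  -- and `q′` the second, so both ranks are below `n`.
  disjoint⇒kappa : ∀ {A : Mat n} → Symmetric A → DisjointVectors A → ∃ λ k → IsKappa A k × k < n
  disjoint⇒kappa {A} sym-A (q , q′ , q≢0 , q′≢0 , disj) =
    let a , ra = rank-exists A S
        b , rb = rank-exists A (complement S)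
        a<n = rank< ra q≢0 (off-support⇒annihilates sym-A q λ w Sw → not-true Sw)
        b<n = rank< rb q′≢0 (off-support⇒annihilates sym-A q′ λ w S′w → disj _ (trans (sym (not-involutive _)) S′w))
        -- The least `k` with `a + b < k + n`, which remains true if the subtraction truncates. Each
        -- rank being below `n` bounds `k` by the other rank.
        k = suc (a + b) ∸ n
        k≤a = m≤n+o⇒m∸n≤o (suc (a + b)) n
                (≤-trans (≤-reflexive (sym (+-suc a b))) (≤-trans (+-monoʳ-≤ a b<n) (≤-reflexive (+-comm a n))))
        k≤b = m≤n+o⇒m∸n≤o (suc (a + b)) n (+-monoˡ-≤ b a<n)
        enough = ≤-trans (m≤n+m∸n (suc (a + b)) n) (≤-reflexive (+-comm n k))
        m , m≤k , cand , minimal = least (candidate? A) k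
          (inj₁ (S , a , b , n , ra , rb , rank-full A , enough , k≤a , k≤b))
    in m , (cand , minimal) , ≤-<-trans m≤k (≤-<-trans k≤a a<n)
    where
    S : ESet n
    S = tau (not ∘ supp A q)
    rank< : ∀ {q S a} → IsRank A S a → Inhabited q → Annihilates A q S → a < n
    rank< ((T , T⊆S , ind , T≡a) , _) q≢0 ann = subst (_< n) T≡a (annihilated-card< q≢0 ann T⊆S ind)

  -- The total rank is `n`, so `k < n` must come from a separation. From `a + b < k + n` and
  -- `k ≤ a`, `k ≤ b`, both sides have rank below `n`, and annihilators of the two sides have
  -- disjoint supports.
  kappa⇒disjoint : ∀ {A : Mat n} {k} → Symmetric A → KappaCandidate A k → k < n → DisjointVectors A
  kappa⇒disjoint {A} sym-A (inj₂ rk) k<n = contradiction (rank-unique rk (rank-full A)) (<⇒≢ k<n)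
  kappa⇒disjoint {A} {k} sym-A (inj₁ (S , a , b , r , ra , rb , rr , a+b< , k≤a , k≤b)) k<n =
    let r≡n = rank-unique rr (rank-full A)
        a<n = subst (a <_) r≡n (+-cancelˡ-< k a r
                (≤-<-trans (≤-trans (+-monoˡ-≤ a k≤b) (≤-reflexive (+-comm b a))) a+b<))
        b<n = subst (b <_) r≡n (+-cancelˡ-< k b r (≤-<-trans (+-monoˡ-≤ b k≤a) a+b<))
        q , q≢0 , ann = rank<⇒annihilator ra a<n
        q′ , q′≢0 , ann′ = rank<⇒annihilator rb b<n
    in q , q′ , q≢0 , q′≢0 , covering⇒disjoint sym-A {S} q q′ ann ann′

  -- Translation between vectors and circuits, and the equivalences.

  disjoint⇒circuits : ∀ {A : Mat n} → DisjointVectors A → Σ (Fin n → Bool) λ X →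
    (Σ (ESet n) λ C → IsTransverseCircuit A C × C ⊆ tau X) ×
    (Σ (ESet n) λ C → IsTransverseCircuit A C × C ⊆ tau (λ v → not (X v)))
  disjoint⇒circuits {A} (q , q′ , q≢0 , q′≢0 , disj) =
    let C′ , tc′ , C′⊆ = vector⇒circuit A q′ q′≢0
    in supp A q , vector⇒circuit A q q≢0 ,
       C′ , tc′ , λ w C′w → cong not (≢true⇒≡false λ s → true≢false (C′⊆ w C′w) (disj _ s))

  occupied⊑ : ∀ {C : ESet n} {X} → C ⊆ tau X → occupied C ⊑ X
  occupied⊑ {C} C⊆X v p with C (φ , v) in Cφ | C (χ , v) in Cχ | C (ψ , v) in Cψ
  ... | true  | _     | _    = C⊆X (φ , v) Cφ
  ... | false | true  | _    = C⊆X (χ , v) Cχ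
  ... | false | false | true = C⊆X (ψ , v) Cψ

  circuits⇒disjoint : ∀ {A : Mat n} {X C C′} → IsTransverseCircuit A C → C ⊆ tau X →
    IsTransverseCircuit A C′ → C′ ⊆ tau (λ v → not (X v)) → DisjointVectors A
  circuits⇒disjoint {A} {X} {C} {C′} tc C⊆ tc′ C′⊆ =
    let q , q≢0 , q⊑ = circuit⇒vector tc
        q′ , q′≢0 , q′⊑ = circuit⇒vector tc′
    in q , q′ , q≢0 , q′≢0 , λ v s → ≢true⇒≡false λ s′ →
         true≢false (occupied⊑ {C} {X} C⊆ v (q⊑ v s)) (not-true (occupied⊑ {C′} {not ∘ X} C′⊆ v (q′⊑ v s′)))

  lightVector⇒circuit : ∀ {A : Mat n} {q} → Inhabited q → 2 * count (supp A q) ≤ n →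
    Σ (ESet n) λ C → IsTransverseCircuit A C × 2 * card C < n + 1
  lightVector⇒circuit {A} {q} q≢0 light =
    let C , (circ , T , tr , C⊆T) , C⊆ = vector⇒circuit A q q≢0
    in C , (circ , T , tr , C⊆T) , ≤-trans
         (s≤s (≤-trans (*-monoʳ-≤ 2 (transverse-card tr C⊆T C⊆)) light)) (≤-reflexive (+-comm 1 n))

  circuit⇒lightVector : ∀ {A : Mat n} {C} → IsTransverseCircuit A C → 2 * card C < n + 1 →
    ∃ λ q → Inhabited q × 2 * count (supp A q) ≤ n
  circuit⇒lightVector {A} {C} tc small =
    let q , q≢0 , q⊑ = circuit⇒vector tc
    in q , q≢0 , ≤-trans (*-monoʳ-≤ 2 (≤-trans (F.∥∥-mono q⊑) (count-occupied C)))
                   (s≤s⁻¹ (≤-trans small (≤-reflexive (+-comm n 1))))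

-- Matches the degree bound `2 * d + 1 < n` with a support of `d + 1` vertices being at most half of
-- `n`.
2*suc : ∀ d → 2 * suc d ≡ suc (2 * d + 1)
2*suc d = solve 1 (λ d → con 2 :* (con 1 :+ d) := con 1 :+ (con 2 :* d :+ con 1)) refl d
  where open +-*-Solver

theorem29 : (n : ℕ) → 4 ≤ n → (A : Mat n) → Symmetric A →
    let
    s1 = Σ (Mat n) λ B → LocallyEquivalent A B × Σ (Fin n) λ v → 2 * degree B v + 1 < n
    s2 = Σ (ESet n) λ C → IsTransverseCircuit A C × 2 * card C < n + 1
    s3 = Σ (Fin n → Bool) λ X → (Σ (ESet n) λ C → IsTransverseCircuit A C × C ⊆ tau X) × (Σ (ESet n) λ C → IsTransverseCircuit A C × C ⊆ tau (λ v → not (X v)))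
    s4 = Σ ℕ λ k → IsKappa A k × k < n
    in (s1 ⇔ s2) × (s2 ⇔ s3) × (s3 ⇔ s4)
theorem29 n _ A sym-A =
  mk⇔
    (λ (B , A∼B , v , low) →
      let q , q≢0 , q≤ = local-degree-weight sym-A A∼B v
      in lightVector⇒circuit {q = q} q≢0 (≤-trans (*-monoʳ-≤ 2 q≤) (subst (_≤ n) (sym (2*suc (degree B v))) low)))
    (λ (C , tc , small) →
      let q , q≢0 , light = circuit⇒lightVector tc small
          B , A∼B , v , low = weight-lowDegree (count q) sym-A q q≢0 ≤-refl
      in B , A∼B , v , subst (_≤ n) (2*suc (degree B v)) (≤-trans (*-monoʳ-≤ 2 low) light)) ,
  mk⇔
    (λ (C , tc , small) →
      let q , q≢0 , light = circuit⇒lightVector tc small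
      in disjoint⇒circuits (lightVector⇒disjoint sym-A q q≢0 light))
    (λ (X , (C , tc , C⊆) , (C′ , tc′ , C′⊆)) →
      let q , q≢0 , light = disjoint⇒lightVector (circuits⇒disjoint {X = X} tc C⊆ tc′ C′⊆)
      in lightVector⇒circuit {q = q} q≢0 light) ,
  mk⇔
    (λ (X , (C , tc , C⊆) , (C′ , tc′ , C′⊆)) → disjoint⇒kappa sym-A (circuits⇒disjoint {X = X} tc C⊆ tc′ C′⊆))
    (λ (k , (cand , _) , k<n) → disjoint⇒circuits (kappa⇒disjoint sym-A cand k<n))
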